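{- Let $d,q\geq 2$ be integers. Then: (a) for every $\theta_w,\theta_1,\theta_0\in\mathbb{Z}$, the density $\delta(q,d;0,\theta_w,0,\theta_1,\theta_0)$ exists; (b) if $d\mid q^n$ for some $n\in\mathbb{N}$, then the density $\delta(q,d;\mathbf{s})$ exists for every $\mathbf{s}\in\mathbb{Z}^5$.
   Context: For an integer $q\geq 2$ and $n\in\mathbb{N}$: $v_q(0)=0$ and, for $n>0$, $v_q(n)=\max\{k: q^k\mid n\}$; $w_q(n)=\sum_{i=0}^n v_q(i)$; $u_q(n)=\sum_{i=0}^n w_q(i)$. For $\mathbf{s}=(\theta_u,\theta_w,\theta_2,\theta_1,\theta_0)\in\mathbb{Z}^5$, $\gamma(A,q,d;\mathbf{s})$ is the number of $n\in\mathbb{N}$, $n<A$, with $\theta_u u_q(n)+\theta_w w_q(n)+\theta_2\frac{n(n+1)}{2}+\theta_1 n+\theta_0\equiv 0\pmod d$, and $\delta(q,d;\mathbf{s})=\lim_{N\to\infty}\gamma(N,q,d;\mathbf{s})/N$ (when the limit exists). -}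

module Defs where

open import Data.Integer.Base as ℤ using (ℤ; +_)
open import Data.Integer.Divisibility.Signed using (_∣?_)
open import Data.List.Base using (filter; length; upTo)
open import Data.List.Extrema.Nat using (max; argmax-sel; v≤max⁺)
open import Data.List.Membership.Propositional using (_∈_; lose)
open import Data.List.Membership.Propositional.Properties
  using (∈-filter⁺; ∈-filter⁻; ∈-upTo⁺)
open import Data.Nat.Base as ℕ using (ℕ; zero; suc; NonZero; _≤_; _<_; s≤s; z≤n; _^_)
import Data.Nat.Divisibility as ℕ
import Data.Nat.Properties as ℕ
open import Data.Product using (Σ; ∃; _×_; _,_; proj₂)
open import Data.Rational.Base as ℚ using (ℚ; 0ℚ)
open import Data.Sum.Base using (_⊎_; inj₁; inj₂)
open import Function.Base using (id)
open import Relation.Binary.PropositionalEquality using (cong; subst; sym)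
open import Relation.Nullary.Negation.Core using (¬_)

-- The maximum ranges over the exponents k ≤ n only; by v-max below this loses
-- nothing when q ≥ 2.  For q < 2 the value is meaningless.
v : ℕ → ℕ → ℕ
v q zero      = 0
v q n@(suc _) = max 0 (filter (λ k → q ^ k ℕ.∣? n) (upTo (suc n)))

private
  k<q^k : ∀ {q} → 2 ≤ q → ∀ k → k < q ^ k
  k<q^k 2≤q zero = s≤s z≤n
  k<q^k {q} 2≤q (suc k) = begin
    suc (suc k)     ≤⟨ s≤s ih ⟩
    1 ℕ.+ q ^ k     ≤⟨ ℕ.+-monoˡ-≤ (q ^ k) (ℕ.≤-trans (s≤s z≤n) ih) ⟩
    q ^ k ℕ.+ q ^ k ≡⟨ cong (q ^ k ℕ.+_) (ℕ.+-identityʳ (q ^ k)) ⟨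
    2 ℕ.* q ^ k     ≤⟨ ℕ.*-monoˡ-≤ (q ^ k) 2≤q ⟩
    q ℕ.* q ^ k     ∎
    where
    open ℕ.≤-Reasoning
    ih = k<q^k 2≤q k

v-divides : ∀ q n → q ^ v q n ℕ.∣ n
v-divides q zero      = ℕ.1∣ 0
v-divides q n@(suc _)
  with argmax-sel id 0 (filter (λ k → q ^ k ℕ.∣? n) (upTo (suc n)))
... | inj₁ v≡0 = subst (λ k → q ^ k ℕ.∣ n) (sym v≡0) (ℕ.1∣ n)
... | inj₂ v∈  = proj₂ (∈-filter⁻ (λ k → q ^ k ℕ.∣? n) {xs = upTo (suc n)} v∈)

v-max : ∀ {q} → 2 ≤ q → ∀ n .{{_ : NonZero n}} k → q ^ k ℕ.∣ n → k ≤ v q n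
v-max {q} 2≤q n@(suc _) k q^k∣n = v≤max⁺ 0 _ (inj₂ (lose k∈ ℕ.≤-refl))
  where
  k∈ : k ∈ filter (λ j → q ^ j ℕ.∣? n) (upTo (suc n))
  k∈ = ∈-filter⁺ (λ j → q ^ j ℕ.∣? n)
         (∈-upTo⁺ (ℕ.<-≤-trans (k<q^k 2≤q k) (ℕ.m≤n⇒m≤1+n (ℕ.∣⇒≤ q^k∣n)))) q^k∣n

-- Σ≤ f n = f 0 + f 1 + ⋯ + f n
Σ≤ : (ℕ → ℕ) → ℕ → ℕ
Σ≤ f zero    = f zero
Σ≤ f (suc n) = Σ≤ f n ℕ.+ f (suc n)

w : ℕ → ℕ → ℕ
w q = Σ≤ (v q)

u : ℕ → ℕ → ℕ
u q = Σ≤ (w q)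

ℤ⁵ : Set
ℤ⁵ = ℤ × ℤ × ℤ × ℤ × ℤ

-- The division by 2 is exact.
form : ℕ → ℤ⁵ → ℕ → ℤ
form q (θu , θw , θ₂ , θ₁ , θ₀) n =
  θu ℤ.* + u q n ℤ.+ θw ℤ.* + w q n ℤ.+ θ₂ ℤ.* + (n ℕ.* suc n ℕ./ 2) ℤ.+ θ₁ ℤ.* + n ℤ.+ θ₀

γ : ℕ → ℕ → ℕ → ℤ⁵ → ℕ
γ A q d s = length (filter (λ n → + d ∣? form q s n) (upTo A))

-- Dedekind cuts: L p means p < x, and U p means x < p.
record ℝ : Set₁ where
  field
    L U         : ℚ → Set
    L-inhabited : ∃ L
    U-inhabited : ∃ U
    L-lower     : ∀ {p r} → p ℚ.< r → L r → L p
    U-upper     : ∀ {p r} → p ℚ.< r → U p → U r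
    L-open      : ∀ {p} → L p → ∃ λ r → p ℚ.< r × L r
    U-open      : ∀ {r} → U r → ∃ λ p → p ℚ.< r × U p
    disjoint    : ∀ {p} → ¬ (L p × U p)
    located     : ∀ {p r} → p ℚ.< r → L p ⊎ U r

-- Sequences are indexed by the positive integers, so that division by the
-- index makes sense.
Seq : Set
Seq = (N : ℕ) .{{_ : NonZero N}} → ℚ

-- |a N - x| < ε is expressed as a N - ε < x < a N + ε.
_⟶_ : Seq → ℝ → Set
a ⟶ x = ∀ ε → 0ℚ ℚ.< ε →
  ∃ λ N₀ → ∀ N .{{_ : NonZero N}} → N₀ ≤ N → L (a N ℚ.- ε) × U (a N ℚ.+ ε)
  where open ℝ x

frequency : ℕ → ℕ → ℤ⁵ → Seq
frequency q d s N = + γ N q d s ℚ./ N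

DensityExists : ℕ → ℕ → ℤ⁵ → Set₁
DensityExists q d s = Σ ℝ λ δ → frequency q d s ⟶ δ

{-# OPTIONS --safe #-}
module Submission where

-- Since w(qn + r) = w(n) + n for r < q, counting the zeros of θ w(n) + c n + t mod d over
-- n = qm + r amounts to counting, over m, those of the form with coefficients
-- (θ, θ + qc, t + rc): it suffices that all these have a density.  Modulo d the orbit of c
-- under c ↦ θ + qc becomes periodic, so assume it has period P ≥ 2.  If h = gcd(c, θ, d) does not
-- divide t there are no zeros; otherwise divide everything by h.  Then f(n) = θ w(n) + c n
-- satisfies f(Qn + m) ≡ f(n) + f(m) for m < Q = qᴾ, and f(1) = c, f(q) = θ + qc generate
-- ℤ/d, so for a power K of Q the values f(m), m < K, cover ℤ/d.  Hence the discrepancy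
-- F(N, t) = d · #{n < N : f(n) + t ≡ 0} − N satisfies F(KN, t) = Σ_{m<K} F(N, t + f(m)), and
-- as F(N, ·) sums to zero over ℤ/d this gives |F(KN, ·)| ≤ (K − 1) max |F(N, ·)|, so
-- F(N, t) = o(N).  For (b), passing from n to qm + r multiplies θu by q and, once d ∣ θu,
-- multiplies θ₂ by q² mod d; if d ∣ qⁿ both vanish mod d after finitely many steps, which
-- leaves the forms of (a).

open import Defs
open import Data.Fin.Base using (toℕ; fromℕ<)
open import Data.Fin.Properties using (pigeonhole; fromℕ<-injective)
open import Data.Integer.Base as ℤ
  using (ℤ; +_; -[1+_]; 0ℤ; 1ℤ; ∣_∣; _+_; _*_; _-_; -_)
open import Data.Integer.DivMod using (_/ℕ_; _%ℕ_; n%ℕd<d; a≡a%ℕn+[a/ℕn]*n)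
open import Data.Integer.Divisibility.Signed
  using (_∣_; _∣?_; divides; ∣-trans; ∣m∣n⇒∣m+n; ∣m+n∣m⇒∣n; ∣m⇒∣-m; ∣n⇒∣m*n; ∣m⇒∣m*n;
         ∣⇒∣ᵤ; ∣ᵤ⇒∣; *-monoˡ-∣; *-cancelʳ-∣)
import Data.Integer.Properties as ℤ
open import Data.Integer.Tactic.RingSolver using (solve-∀)
open import Data.List.Base using (length; filter; upTo; _++_; _∷ʳ_; [_])
open import Data.List.Properties
  using (upTo-∷ʳ; filter-++; filter-accept; filter-reject; length-++)
open import Data.Nat.Base as ℕ using (ℕ; zero; suc; NonZero; _≤_; _<_; s≤s; z≤n; _^_)
import Data.Nat.DivMod as ℕ
import Data.Nat.Divisibility as ℕ
import Data.Nat.GCD as ℕ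
import Data.Nat.Properties as ℕ
import Data.Nat.Tactic.RingSolver as ℕSolver
open import Data.Product using (∃; ∃₂; _×_; _,_; proj₁; proj₂)
open import Data.Rational.Base as ℚ using (ℚ; mkℚ; 1ℚ; toℚᵘ)
import Data.Rational.Properties as ℚ
open import Data.Rational.Unnormalised.Base as ℚᵘ using (mkℚᵘ)
import Data.Rational.Unnormalised.Properties as ℚᵘ
open import Data.Sum.Base using (inj₁; inj₂)
open import Function.Base using (_∘_; case_of_)
open import Relation.Binary.PropositionalEquality hiding ([_])
open import Relation.Nullary using (¬_; yes; no; contradiction)

-- Finite sums

Σ< : (ℕ → ℤ) → ℕ → ℤ
Σ< f zero    = 0ℤ
Σ< f (suc n) = Σ< f n + f n

Σ<-cong : ∀ {f g} n → (∀ i → i < n → f i ≡ g i) → Σ< f n ≡ Σ< g n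
Σ<-cong zero    f≡g = refl
Σ<-cong (suc n) f≡g =
  cong₂ _+_ (Σ<-cong n λ i i<n → f≡g i (ℕ.m≤n⇒m≤1+n i<n)) (f≡g n ℕ.≤-refl)

Σ<-+ : ∀ f g n → Σ< (λ i → f i + g i) n ≡ Σ< f n + Σ< g n
Σ<-+ f g zero    = refl
Σ<-+ f g (suc n) rewrite Σ<-+ f g n = lemma (Σ< f n) (Σ< g n) (f n) (g n)
  where
  lemma : ∀ a b c d → a + b + (c + d) ≡ a + c + (b + d)
  lemma = solve-∀

Σ<-*ˡ : ∀ c f n → Σ< (λ i → c * f i) n ≡ c * Σ< f n
Σ<-*ˡ c f zero    = sym (ℤ.*-zeroʳ c)
Σ<-*ˡ c f (suc n) rewrite Σ<-*ˡ c f n = sym (ℤ.*-distribˡ-+ c (Σ< f n) (f n))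

Σ<-const : ∀ c n → Σ< (λ _ → c) n ≡ + n * c
Σ<-const c zero    = refl
Σ<-const c (suc n) rewrite Σ<-const c n | ℤ.pos-+ 1 n = lemma (+ n) c
  where
  lemma : ∀ x c → x * c + c ≡ (1ℤ + x) * c
  lemma = solve-∀

Σ<-swap : ∀ (f : ℕ → ℕ → ℤ) m n →
  Σ< (λ i → Σ< (f i) n) m ≡ Σ< (λ j → Σ< (λ i → f i j) m) n
Σ<-swap f zero    n = sym (trans (Σ<-const 0ℤ n) (ℤ.*-zeroʳ (+ n)))
Σ<-swap f (suc m) n rewrite Σ<-swap f m n = sym (Σ<-+ (λ j → Σ< (λ i → f i j) m) (f m) n)

Σ<-split : ∀ f m n → Σ< f (m ℕ.+ n) ≡ Σ< f m + Σ< (λ i → f (m ℕ.+ i)) n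
Σ<-split f m zero    rewrite ℕ.+-identityʳ m = sym (ℤ.+-identityʳ (Σ< f m))
Σ<-split f m (suc n) rewrite ℕ.+-suc m n | Σ<-split f m n =
  ℤ.+-assoc (Σ< f m) (Σ< (λ i → f (m ℕ.+ i)) n) (f (m ℕ.+ n))

-- The range is cut into n blocks of length q; swapping the two sums then collects the indices by
-- residue class r, which is where a recursion in base q applies.
Σ<-block : ∀ f q n → Σ< f (q ℕ.* n) ≡ Σ< (λ r → Σ< (λ i → f (q ℕ.* i ℕ.+ r)) n) q
Σ<-block f q n = trans (blocks n) (Σ<-swap (λ i r → f (q ℕ.* i ℕ.+ r)) n q)
  where
  blocks : ∀ n → Σ< f (q ℕ.* n) ≡ Σ< (λ i → Σ< (λ r → f (q ℕ.* i ℕ.+ r)) q) n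
  blocks zero    rewrite ℕ.*-zeroʳ q = refl
  blocks (suc n) rewrite ℕ.*-suc q n | ℕ.+-comm q (q ℕ.* n)
    | Σ<-split f (q ℕ.* n) q | blocks n = refl

∣Σ<∣≤ : ∀ f n B → (∀ i → i < n → ∣ f i ∣ ≤ B) → ∣ Σ< f n ∣ ≤ n ℕ.* B
∣Σ<∣≤ f zero    B bound = z≤n
∣Σ<∣≤ f (suc n) B bound = begin
  ∣ Σ< f n + f n ∣         ≤⟨ ℤ.∣i+j∣≤∣i∣+∣j∣ (Σ< f n) (f n) ⟩
  ∣ Σ< f n ∣ ℕ.+ ∣ f n ∣   ≤⟨ ℕ.+-mono-≤
    (∣Σ<∣≤ f n B λ i i<n → bound i (ℕ.m≤n⇒m≤1+n i<n)) (bound n ℕ.≤-refl) ⟩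
  n ℕ.* B ℕ.+ B            ≡⟨ ℕ.+-comm (n ℕ.* B) B ⟩
  suc n ℕ.* B              ∎
  where open ℕ.≤-Reasoning

Σ<-zero : ∀ {f} n → (∀ i → i < n → f i ≡ 0ℤ) → Σ< f n ≡ 0ℤ
Σ<-zero n f≡0 = trans (Σ<-cong n f≡0) (trans (Σ<-const 0ℤ n) (ℤ.*-zeroʳ (+ n)))

Σ<-single : ∀ f {n} k → k < n → (∀ i → i < n → i ≢ k → f i ≡ 0ℤ) → Σ< f n ≡ f k
Σ<-single f {suc n} k k<1+n f≡0 with n ℕ.≟ k
... | yes refl rewrite Σ<-zero {f} n (λ i i<n → f≡0 i (ℕ.m≤n⇒m≤1+n i<n) (ℕ.<⇒≢ i<n)) =
  ℤ.+-identityˡ (f n)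
... | no n≢k rewrite f≡0 n ℕ.≤-refl n≢k
  | Σ<-single f {n} k (ℕ.≤∧≢⇒< (ℕ.≤-pred k<1+n) (n≢k ∘ sym)) (λ i i<n → f≡0 i (ℕ.m≤n⇒m≤1+n i<n)) =
  ℤ.+-identityʳ (f k)

Σ<-nonNeg : ∀ f n → (∀ i → i < n → 0ℤ ℤ.≤ f i) → 0ℤ ℤ.≤ Σ< f n
Σ<-nonNeg f zero    0≤f = ℤ.≤-refl
Σ<-nonNeg f (suc n) 0≤f =
  ℤ.+-mono-≤ (Σ<-nonNeg f n λ i i<n → 0≤f i (ℕ.m≤n⇒m≤1+n i<n)) (0≤f n ℕ.≤-refl)

term≤Σ< : ∀ f {n} k → k < n → (∀ i → i < n → 0ℤ ℤ.≤ f i) → f k ℤ.≤ Σ< f n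
term≤Σ< f {suc n} k k<1+n 0≤f with n ℕ.≟ k
... | yes refl = subst (ℤ._≤ Σ< f n + f n) (ℤ.+-identityˡ (f n))
  (ℤ.+-monoˡ-≤ (f n) (Σ<-nonNeg f n λ i i<n → 0≤f i (ℕ.m≤n⇒m≤1+n i<n)))
... | no n≢k = subst (ℤ._≤ Σ< f n + f n) (ℤ.+-identityʳ (f k))
  (ℤ.+-mono-≤
    (term≤Σ< f k (ℕ.≤∧≢⇒< (ℕ.≤-pred k<1+n) (n≢k ∘ sym)) λ i i<n → 0≤f i (ℕ.m≤n⇒m≤1+n i<n))
    (0≤f n ℕ.≤-refl))

-- With nonnegative weights the triangle inequality costs only their total, not the number of terms.
-- This gives the contraction factor in `F-contracts`.
∣Σ<-weighted∣≤ : ∀ (c g : ℕ → ℤ) n B → (∀ i → 0ℤ ℤ.≤ c i) → (∀ i → ∣ g i ∣ ≤ B) →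
  + ∣ Σ< (λ i → c i * g i) n ∣ ℤ.≤ Σ< c n * + B
∣Σ<-weighted∣≤ c g zero    B 0≤c bound = ℤ.≤-refl
∣Σ<-weighted∣≤ c g (suc n) B 0≤c bound = begin
  + ∣ Σ< (λ i → c i * g i) n + c n * g n ∣
    ≤⟨ ℤ.+≤+ (ℤ.∣i+j∣≤∣i∣+∣j∣ (Σ< (λ i → c i * g i) n) (c n * g n)) ⟩
  + (∣ Σ< (λ i → c i * g i) n ∣ ℕ.+ ∣ c n * g n ∣)
    ≡⟨ ℤ.pos-+ ∣ Σ< (λ i → c i * g i) n ∣ ∣ c n * g n ∣ ⟩
  + ∣ Σ< (λ i → c i * g i) n ∣ + + ∣ c n * g n ∣
    ≤⟨ ℤ.+-mono-≤ (∣Σ<-weighted∣≤ c g n B 0≤c bound) last ⟩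
  Σ< c n * + B + c n * + B
    ≡⟨ ℤ.*-distribʳ-+ (+ B) (Σ< c n) (c n) ⟨
  (Σ< c n + c n) * + B ∎
  where
  open ℤ.≤-Reasoning
  last : + ∣ c n * g n ∣ ℤ.≤ c n * + B
  last = begin
    + ∣ c n * g n ∣           ≡⟨ cong +_ (ℤ.abs-* (c n) (g n)) ⟩
    + (∣ c n ∣ ℕ.* ∣ g n ∣)   ≤⟨ ℤ.+≤+ (ℕ.*-monoʳ-≤ ∣ c n ∣ (bound n)) ⟩
    + (∣ c n ∣ ℕ.* B)         ≡⟨ ℤ.pos-* ∣ c n ∣ B ⟩
    + ∣ c n ∣ * + B           ≡⟨ cong (_* + B) (ℤ.0≤i⇒+∣i∣≡i (0≤c n)) ⟩
    c n * + B                 ∎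

-- Congruences

infix 4 _≡_[mod_]

-- A record, so that unification can recover `x` and `y` from the type; from `+ d ∣ x - y` alone it
-- could not.
record _≡_[mod_] (x y : ℤ) (d : ℕ) : Set where
  constructor congruent
  field difference : + d ∣ x - y

open _≡_[mod_] public

≡⇒≡mod : ∀ {d x y} → x ≡ y → x ≡ y [mod d ]
≡⇒≡mod {d} {x} refl = congruent (divides 0ℤ (trans (ℤ.+-inverseʳ x) (sym (ℤ.*-zeroˡ (+ d)))))

mod-refl : ∀ {d} x → x ≡ x [mod d ]
mod-refl x = ≡⇒≡mod refl

mod-sym : ∀ {d x y} → x ≡ y [mod d ] → y ≡ x [mod d ]
mod-sym {d} {x} {y} (congruent p) = congruent (subst (+ d ∣_) (lemma x y) (∣m⇒∣-m p))
  where
  lemma : ∀ x y → - (x - y) ≡ y - x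
  lemma = solve-∀

mod-trans : ∀ {d x y z} → x ≡ y [mod d ] → y ≡ z [mod d ] → x ≡ z [mod d ]
mod-trans {d} {x} {y} {z} (congruent p) (congruent r) =
  congruent (subst (+ d ∣_) (lemma x y z) (∣m∣n⇒∣m+n p r))
  where
  lemma : ∀ x y z → x - y + (y - z) ≡ x - z
  lemma = solve-∀

mod-+ : ∀ {d x y x′ y′} → x ≡ y [mod d ] → x′ ≡ y′ [mod d ] → x + x′ ≡ y + y′ [mod d ]
mod-+ {d} {x} {y} {x′} {y′} (congruent p) (congruent r) =
  congruent (subst (+ d ∣_) (lemma x y x′ y′) (∣m∣n⇒∣m+n p r))
  where
  lemma : ∀ x y x′ y′ → x - y + (x′ - y′) ≡ x + x′ - (y + y′)
  lemma = solve-∀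

mod-*ˡ : ∀ {d x y} c → x ≡ y [mod d ] → c * x ≡ c * y [mod d ]
mod-*ˡ {d} {x} {y} c (congruent p) = congruent (subst (+ d ∣_) (lemma c x y) (∣n⇒∣m*n c p))
  where
  lemma : ∀ c x y → c * (x - y) ≡ c * x - c * y
  lemma = solve-∀

mod-*ʳ : ∀ {d x y} c → x ≡ y [mod d ] → x * c ≡ y * c [mod d ]
mod-*ʳ {d} {x} {y} c x≡y = subst₂ (_≡_[mod d ]) (ℤ.*-comm c x) (ℤ.*-comm c y) (mod-*ˡ c x≡y)

mod-∣ : ∀ {d x y} → x ≡ y [mod d ] → + d ∣ y → + d ∣ x
mod-∣ {d} {x} {y} (congruent p) d∣y = subst (+ d ∣_) (lemma x y) (∣m∣n⇒∣m+n p d∣y)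
  where
  lemma : ∀ x y → x - y + y ≡ x
  lemma = solve-∀

-- Residues modulo d

residue : ∀ d .{{_ : NonZero d}} → ℤ → ℕ
residue d x = x %ℕ d

residue< : ∀ d .{{_ : NonZero d}} x → residue d x < d
residue< d x = n%ℕd<d x d

residue-mod : ∀ d .{{_ : NonZero d}} x → x ≡ + residue d x [mod d ]
residue-mod d x = congruent (divides (x /ℕ d)
  (trans (cong (_- + (x %ℕ d)) (a≡a%ℕn+[a/ℕn]*n x d)) (lemma (+ (x %ℕ d)) (x /ℕ d * + d))))
  where
  lemma : ∀ r y → r + y - r ≡ y
  lemma = solve-∀

-- The difference is a multiple of d of absolute value below d, hence zero.
residue-unique : ∀ d {a b} → a < d → b < d → + a ≡ + b [mod d ] → a ≡ b
residue-unique d {a} {b} a<d b<d (congruent d∣a-b) =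
  ℤ.+-injective (ℤ.i-j≡0⇒i≡j (+ a) (+ b) (ℤ.∣i∣≡0⇒i≡0 (small (∣⇒∣ᵤ d∣a-b) ∣a-b∣<d)))
  where
  small : ∀ {n} → d ℕ.∣ n → n < d → n ≡ 0
  small {zero}  _   _   = refl
  small {suc n} d∣n n<d = contradiction (ℕ.∣⇒≤ d∣n) (ℕ.<⇒≱ n<d)
  ∣a-b∣<d : ∣ + a - + b ∣ < d
  ∣a-b∣<d rewrite ℤ.m-n≡m⊖n a b = ℕ.≤-<-trans (ℤ.∣m⊝n∣≤m⊔n a b) (ℕ.⊔-lub a<d b<d)

-- The indicator of divisibility

ind : ℕ → ℤ → ℤ
ind d x with + d ∣? x
... | yes _ = 1ℤ
... | no  _ = 0ℤ

ind-yes : ∀ {d x} → + d ∣ x → ind d x ≡ 1ℤ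
ind-yes {d} {x} d∣x with + d ∣? x
... | yes _   = refl
... | no  d∤x = contradiction d∣x d∤x

ind-no : ∀ {d x} → ¬ + d ∣ x → ind d x ≡ 0ℤ
ind-no {d} {x} d∤x with + d ∣? x
... | yes d∣x = contradiction d∣x d∤x
... | no  _   = refl

-- Two moduli are allowed because `scaled-density` compares divisibility by d with divisibility by d
-- h.
ind-cong : ∀ {d x d′ x′} → (+ d ∣ x → + d′ ∣ x′) → (+ d′ ∣ x′ → + d ∣ x) → ind d x ≡ ind d′ x′
ind-cong {d} {x} to from with + d ∣? x
... | yes d∣x = sym (ind-yes (to d∣x))
... | no  d∤x = sym (ind-no (d∤x ∘ from))

ind-mod : ∀ {d x y} → x ≡ y [mod d ] → ind d x ≡ ind d y
ind-mod p = ind-cong (mod-∣ (mod-sym p)) (mod-∣ p)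

0≤ind : ∀ d x → 0ℤ ℤ.≤ ind d x
0≤ind d x with + d ∣? x
... | yes _ = ℤ.+≤+ z≤n
... | no  _ = ℤ.+≤+ z≤n

∣ind∣≤1 : ∀ d x → ∣ ind d x ∣ ≤ 1
∣ind∣≤1 d x with + d ∣? x
... | yes _ = ℕ.≤-refl
... | no  _ = z≤n

Periodic : ℕ → (ℤ → ℤ) → Set
Periodic d g = ∀ {x y} → x ≡ y [mod d ] → g x ≡ g y

-- Exactly one x < d is congruent to y, so the indicator acts as a delta function on ℤ/d.
Σ<-residues : ∀ d .{{_ : NonZero d}} g → Periodic d g → ∀ y →
  Σ< (λ x → ind d (y - + x) * g (+ x)) d ≡ g y
Σ<-residues d g per y = begin
  Σ< (λ x → ind d (y - + x) * g (+ x)) d ≡⟨ Σ<-single _ (residue d y) (residue< d y) vanish ⟩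
  ind d (y - + residue d y) * g (+ residue d y)
    ≡⟨ cong (_* g (+ residue d y)) (ind-yes (difference (residue-mod d y))) ⟩
  1ℤ * g (+ residue d y) ≡⟨ ℤ.*-identityˡ _ ⟩
  g (+ residue d y) ≡⟨ per (residue-mod d y) ⟨
  g y ∎
  where
  open ≡-Reasoning
  vanish : ∀ i → i < d → i ≢ residue d y → ind d (y - + i) * g (+ i) ≡ 0ℤ
  vanish i i<d i≢r = trans (cong (_* g (+ i)) (ind-no λ d∣y-i →
    i≢r (residue-unique d i<d (residue< d y)
      (mod-trans (mod-sym (congruent d∣y-i)) (residue-mod d y)))))
    (ℤ.*-zeroˡ (g (+ i)))

Σ<-ind-residues : ∀ d .{{_ : NonZero d}} y → Σ< (λ x → ind d (y - + x)) d ≡ 1ℤ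
Σ<-ind-residues d y = trans (Σ<-cong d λ x _ → sym (ℤ.*-identityʳ _))
  (Σ<-residues d (λ _ → 1ℤ) (λ _ → refl) y)

-- Bézout's identity for the absolute values comes in two shapes, according to which side carries h.
-- Both reduce to `solve`, the second with negated coefficients, and `sign` moves the signs of x and
-- y into the coefficients.
bezout : ∀ x y → ∃ λ h → (+ h ∣ x) × (+ h ∣ y) × ∃₂ λ α β → + h ≡ α * x + β * y
bezout x y with ℕ.Bézout.lemma ∣ x ∣ ∣ y ∣
... | ℕ.Bézout.result h g identity =
  h , ∣ᵤ⇒∣ (ℕ.GCD.gcd∣m g) , ∣ᵤ⇒∣ (ℕ.GCD.gcd∣n g) , combine identity
  where
  sign : ∀ z → ∃ λ σ → + ∣ z ∣ ≡ σ * z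
  sign (+ n)      = 1ℤ , sym (ℤ.*-identityˡ (+ n))
  sign (-[1+ n ]) = - 1ℤ , sym (ℤ.-1*i≡-i -[1+ n ])
  solve : ∀ X Y → + h + Y * + ∣ y ∣ ≡ X * + ∣ x ∣ → ∃₂ λ α β → + h ≡ α * x + β * y
  solve X Y eq with σ , ∣x∣≡ ← sign x | τ , ∣y∣≡ ← sign y =
    X * σ , - (Y * τ) , trans (lemma₁ (+ h) (Y * + ∣ y ∣)) (trans (cong (_- Y * + ∣ y ∣) eq)
      (trans (cong₂ (λ a b → X * a - Y * b) ∣x∣≡ ∣y∣≡) (lemma₂ X Y σ τ x y)))
    where
    lemma₁ : ∀ h z → h ≡ h + z - z
    lemma₁ = solve-∀
    lemma₂ : ∀ X Y σ τ x y → X * (σ * x) - Y * (τ * y) ≡ X * σ * x + - (Y * τ) * y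
    lemma₂ = solve-∀
  lift : ∀ a k b l m → a ℕ.+ k ℕ.* b ≡ l ℕ.* m → + a + + k * + b ≡ + l * + m
  lift a k b l m eq = trans (cong (λ z → + a + z) (sym (ℤ.pos-* k b)))
    (trans (sym (ℤ.pos-+ a (k ℕ.* b))) (trans (cong +_ eq) (ℤ.pos-* l m)))
  combine : ℕ.Bézout.Identity h ∣ x ∣ ∣ y ∣ → ∃₂ λ α β → + h ≡ α * x + β * y
  combine (ℕ.Bézout.+- X Y eq) = solve (+ X) (+ Y) (lift h Y (∣ y ∣) X (∣ x ∣) eq)
  combine (ℕ.Bézout.-+ X Y eq) = solve (- + X) (- + Y)
    (trans (cong (λ z → + h + z) (sym (ℤ.neg-distribˡ-* (+ Y) (+ ∣ y ∣))))
      (negate (+ h) (+ X * + ∣ x ∣) (+ Y * + ∣ y ∣) (lift h X (∣ x ∣) Y (∣ y ∣) eq)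
        (ℤ.neg-distribˡ-* (+ X) (+ ∣ x ∣))))
    where
    negate : ∀ h a b {c} → h + a ≡ b → - a ≡ c → h + - b ≡ c
    negate h a _ refl refl = lemma h a
      where
      lemma : ∀ h a → h + - (h + a) ≡ - a
      lemma = solve-∀

divMod : ∀ q .{{_ : NonZero q}} N → N ≡ q ℕ.* (N ℕ./ q) ℕ.+ N ℕ.% q
divMod q N = trans (ℕ.m≡m%n+[m/n]*n N q)
  (trans (ℕ.+-comm (N ℕ.% q) _) (cong (ℕ._+ N ℕ.% q) (ℕ.*-comm (N ℕ./ q) q)))

-- Densities up to o(N)

-- This is e(N) = o(N) without division: 1/m plays the role of ε, and `C` absorbs the small N.
Negligible : (ℕ → ℤ) → Set
Negligible e = ∀ m → ∃ λ C → ∀ N → m ℕ.* ∣ e N ∣ ≤ N ℕ.+ C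

Negligible-cong : ∀ {e f} → (∀ N → e N ≡ f N) → Negligible e → Negligible f
Negligible-cong e≡f neg m =
  proj₁ (neg m) , λ N → subst (λ x → m ℕ.* ∣ x ∣ ≤ N ℕ.+ proj₁ (neg m)) (e≡f N) (proj₂ (neg m) N)

Negligible-0 : Negligible (λ _ → 0ℤ)
Negligible-0 m = 0 , λ N → subst (_≤ N ℕ.+ 0) (sym (ℕ.*-zeroʳ m)) z≤n

Negligible-+ : ∀ e f → Negligible e → Negligible f → Negligible (λ N → e N + f N)
Negligible-+ e f neg neg′ m with C , bound ← neg (2 ℕ.* m) | C′ , bound′ ← neg′ (2 ℕ.* m) =
  C ℕ.+ C′ , λ N → ℕ.*-cancelˡ-≤ 2 (begin
    2 ℕ.* (m ℕ.* ∣ e N + f N ∣)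
      ≤⟨ ℕ.*-monoʳ-≤ 2 (ℕ.*-monoʳ-≤ m (ℤ.∣i+j∣≤∣i∣+∣j∣ (e N) (f N))) ⟩
    2 ℕ.* (m ℕ.* (∣ e N ∣ ℕ.+ ∣ f N ∣))
      ≡⟨ lemma m ∣ e N ∣ ∣ f N ∣ ⟩
    2 ℕ.* m ℕ.* ∣ e N ∣ ℕ.+ 2 ℕ.* m ℕ.* ∣ f N ∣
      ≤⟨ ℕ.+-mono-≤ (bound N) (bound′ N) ⟩
    N ℕ.+ C ℕ.+ (N ℕ.+ C′)
      -- Padding turns the bound into a multiple of 2, so that the factor 2 cancels.
      ≤⟨ ℕ.m≤m+n _ (C ℕ.+ C′) ⟩
    N ℕ.+ C ℕ.+ (N ℕ.+ C′) ℕ.+ (C ℕ.+ C′)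
      ≡⟨ lemma′ N C C′ ⟩
    2 ℕ.* (N ℕ.+ (C ℕ.+ C′)) ∎)
  where
  open ℕ.≤-Reasoning
  lemma : ∀ m x y → 2 ℕ.* (m ℕ.* (x ℕ.+ y)) ≡ 2 ℕ.* m ℕ.* x ℕ.+ 2 ℕ.* m ℕ.* y
  lemma = ℕSolver.solve-∀
  lemma′ : ∀ N C D → N ℕ.+ C ℕ.+ (N ℕ.+ D) ℕ.+ (C ℕ.+ D) ≡ 2 ℕ.* (N ℕ.+ (C ℕ.+ D))
  lemma′ = ℕSolver.solve-∀

Negligible-*ˡ : ∀ c e → Negligible e → Negligible (λ N → c * e N)
Negligible-*ˡ c e neg m with C , bound ← neg (m ℕ.* ∣ c ∣) =
  C , λ N → subst (_≤ N ℕ.+ C)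
    (trans (ℕ.*-assoc m ∣ c ∣ ∣ e N ∣) (cong (m ℕ.*_) (sym (ℤ.abs-* c (e N))))) (bound N)

-- The density is the rational a / b, with the denominator cleared: b G(N) = a N + o(N).
HasDensity : (ℕ → ℤ) → Set
HasDensity G = ∃ λ a → ∃ λ b → NonZero b × Negligible (λ N → + b * G N - a * + N)

HasDensity-cong : ∀ {G H} → (∀ N → G N ≡ H N) → HasDensity G → HasDensity H
HasDensity-cong G≡H (a , b , b≢0 , neg) =
  a , b , b≢0 , Negligible-cong (λ N → cong (λ x → + b * x - a * + N) (G≡H N)) neg

HasDensity-0 : HasDensity (λ _ → 0ℤ)
HasDensity-0 = 0ℤ , 1 , _ , Negligible-0

HasDensity-+ : ∀ {G H} → HasDensity G → HasDensity H → HasDensity (λ N → G N + H N)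
HasDensity-+ {G} {H} (a , b , b≢0 , neg) (a′ , b′ , b′≢0 , neg′) =
  a * + b′ + a′ * + b , b ℕ.* b′ , ℕ.m*n≢0 b b′ {{b≢0}} {{b′≢0}} ,
  Negligible-cong
    (λ N → trans (lemma (+ b) (+ b′) a a′ (G N) (H N) (+ N))
      (cong (λ x → x * (G N + H N) - (a * + b′ + a′ * + b) * + N) (sym (ℤ.pos-* b b′))))
    (Negligible-+ (λ N → + b′ * e N) (λ N → + b * e′ N)
      (Negligible-*ˡ (+ b′) e neg) (Negligible-*ˡ (+ b) e′ neg′))
  where
  e e′ : ℕ → ℤ
  e  N = + b * G N - a * + N
  e′ N = + b′ * H N - a′ * + N
  lemma : ∀ b b′ a a′ G H N → b′ * (b * G - a * N) + b * (b′ * H - a′ * N)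
    ≡ b * b′ * (G + H) - (a * b′ + a′ * b) * N
  lemma = solve-∀

HasDensity-Σ< : ∀ {G : ℕ → ℕ → ℤ} q → (∀ r → r < q → HasDensity (G r)) →
  HasDensity (λ N → Σ< (λ r → G r N) q)
HasDensity-Σ< zero    dens = HasDensity-0
HasDensity-Σ< (suc q) dens =
  HasDensity-+ (HasDensity-Σ< q λ r r<q → dens r (ℕ.m≤n⇒m≤1+n r<q)) (dens q ℕ.≤-refl)

Negligible-bounded : ∀ e B → (∀ N → ∣ e N ∣ ≤ B) → Negligible e
Negligible-bounded e B bound m =
  m ℕ.* B , λ N → ℕ.≤-trans (ℕ.*-monoʳ-≤ m (bound N)) (ℕ.m≤n+m (m ℕ.* B) N)

Negligible-/ : ∀ q .{{_ : NonZero q}} e → Negligible e → Negligible (λ N → e (N ℕ./ q))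
Negligible-/ q e neg m with C , bound ← neg m =
  C , λ N → ℕ.≤-trans (bound (N ℕ./ q)) (ℕ.+-monoˡ-≤ C (ℕ.m/n≤m N q))

-- Splitting N = q M + ρ, the incomplete last block contributes a bounded error.
HasDensity-block : ∀ q .{{_ : NonZero q}} (g : ℕ → ℤ) → (∀ n → ∣ g n ∣ ≤ 1) →
  (∀ r → r < q → HasDensity (Σ< λ n → g (q ℕ.* n ℕ.+ r))) → HasDensity (Σ< g)
HasDensity-block q g bounded dens with a , b , b≢0 , neg ← HasDensity-Σ< q dens =
  -- The q classes together have density a / b relative to the number M of blocks, hence a / (q b)
  -- relative to N.
  a , q ℕ.* b , (let instance _ = b≢0 in ℕ.m*n≢0 q b) ,
  Negligible-cong (λ N → sym (decompose N))
    (Negligible-+ (λ N → + q * main (N ℕ./ q)) rest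
      (Negligible-*ˡ (+ q) (λ N → main (N ℕ./ q)) (Negligible-/ q main neg))
      (Negligible-bounded rest (q ℕ.* b ℕ.* q ℕ.+ ∣ a ∣ ℕ.* q) bound))
  where
  tail : ℕ → ℤ
  tail N = Σ< (λ i → g (q ℕ.* (N ℕ./ q) ℕ.+ i)) (N ℕ.% q)
  blocks : ℕ → ℤ
  blocks M = Σ< (λ r → Σ< (λ n → g (q ℕ.* n ℕ.+ r)) M) q
  main : ℕ → ℤ
  main M = + b * blocks M - a * + M
  rest : ℕ → ℤ
  rest N = + (q ℕ.* b) * tail N - a * + (N ℕ.% q)
  decompose : ∀ N → + (q ℕ.* b) * Σ< g N - a * + N
    ≡ + q * (+ b * blocks (N ℕ./ q) - a * + (N ℕ./ q)) + rest N
  decompose N = begin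
    + (q ℕ.* b) * Σ< g N - a * + N
      ≡⟨ cong (λ n → + (q ℕ.* b) * Σ< g n - a * + n) (divMod q N) ⟩
    + (q ℕ.* b) * Σ< g (q ℕ.* M ℕ.+ ρ) - a * + (q ℕ.* M ℕ.+ ρ)
      ≡⟨ cong₂ (λ x y → + (q ℕ.* b) * x - a * y)
           (trans (Σ<-split g (q ℕ.* M) ρ) (cong (_+ tail N) (Σ<-block g q M)))
           (trans (ℤ.pos-+ (q ℕ.* M) ρ) (cong (_+ + ρ) (ℤ.pos-* q M))) ⟩
    + (q ℕ.* b) * (blocks M + tail N) - a * (+ q * + M + + ρ)
      ≡⟨ cong (λ x → x * (blocks M + tail N) - a * (+ q * + M + + ρ)) (ℤ.pos-* q b) ⟩
    + q * + b * (blocks M + tail N) - a * (+ q * + M + + ρ)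
      ≡⟨ lemma (+ q) (+ b) (blocks M) (tail N) a (+ M) (+ ρ) ⟩
    + q * (+ b * blocks M - a * + M) + (+ q * + b * tail N - a * + ρ)
      ≡⟨ cong (λ x → + q * (+ b * blocks M - a * + M) + (x * tail N - a * + ρ)) (ℤ.pos-* q b) ⟨
    + q * (+ b * blocks M - a * + M) + rest N ∎
    where
    open ≡-Reasoning
    M = N ℕ./ q
    ρ = N ℕ.% q
    lemma : ∀ q b G T a M ρ → q * b * (G + T) - a * (q * M + ρ)
      ≡ q * (b * G - a * M) + (q * b * T - a * ρ)
    lemma = solve-∀
  bound : ∀ N → ∣ rest N ∣ ≤ q ℕ.* b ℕ.* q ℕ.+ ∣ a ∣ ℕ.* q
  bound N = begin
    ∣ rest N ∣
      ≤⟨ ℤ.∣i-j∣≤∣i∣+∣j∣ (+ (q ℕ.* b) * tail N) (a * + ρ) ⟩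
    ∣ + (q ℕ.* b) * tail N ∣ ℕ.+ ∣ a * + ρ ∣
      ≡⟨ cong₂ ℕ._+_ (ℤ.abs-* (+ (q ℕ.* b)) (tail N)) (ℤ.abs-* a (+ ρ)) ⟩
    q ℕ.* b ℕ.* ∣ tail N ∣ ℕ.+ ∣ a ∣ ℕ.* ρ
      ≤⟨ ℕ.+-mono-≤ (ℕ.*-monoʳ-≤ (q ℕ.* b) tail≤q) (ℕ.*-monoʳ-≤ ∣ a ∣ ρ≤q) ⟩
    q ℕ.* b ℕ.* q ℕ.+ ∣ a ∣ ℕ.* q ∎
    where
    open ℕ.≤-Reasoning
    ρ = N ℕ.% q
    ρ≤q : ρ ≤ q
    ρ≤q = ℕ.<⇒≤ (ℕ.m%n<n N q)
    tail≤q : ∣ tail N ∣ ≤ q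
    tail≤q = ℕ.≤-trans (∣Σ<∣≤ _ ρ 1 λ i _ → bounded _)
      (subst (_≤ q) (sym (ℕ.*-identityʳ ρ)) ρ≤q)

-- Dedekind reals

-- `upTo` is unfolded at its right end, to match the recursion of `Σ<` on the last index.
γ-Σ< : ∀ A q d s → + γ A q d s ≡ Σ< (λ n → ind d (form q s n)) A
γ-Σ< zero    q d s = refl
γ-Σ< (suc A) q d s = begin
  + length (filter P? (upTo (suc A)))
    ≡⟨ cong (λ ns → + length (filter P? ns)) (upTo-∷ʳ A) ⟨
  + length (filter P? (upTo A ∷ʳ A))
    ≡⟨ cong (λ ns → + length ns) (filter-++ P? (upTo A) [ A ]) ⟩
  + length (filter P? (upTo A) ++ filter P? [ A ])
    ≡⟨ cong +_ (length-++ (filter P? (upTo A))) ⟩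
  + (γ A q d s ℕ.+ length (filter P? [ A ]))
    ≡⟨ ℤ.pos-+ (γ A q d s) _ ⟩
  + γ A q d s + + length (filter P? [ A ])
    ≡⟨ cong₂ _+_ (γ-Σ< A q d s) last ⟩
  Σ< (λ n → ind d (form q s n)) (suc A) ∎
  where
  open ≡-Reasoning
  P? = λ n → + d ∣? form q s n
  last : + length (filter P? [ A ]) ≡ ind d (form q s A)
  last = case + d ∣? form q s A of λ where
    (yes d∣x) → trans (cong (+_ ∘ length) (filter-accept P? d∣x)) (sym (ind-yes d∣x))
    (no  d∤x) → trans (cong (+_ ∘ length) (filter-reject P? d∤x)) (sym (ind-no d∤x))

fromℚ : ℚ → ℝ
fromℚ x = record
  { L           = ℚ._< x
  ; U           = x ℚ.<_
  ; L-inhabited = x ℚ.- 1ℚ , x-1<x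
  ; U-inhabited = x ℚ.+ 1ℚ , x<x+1
  ; L-lower     = λ p<r r<x → ℚ.<-trans p<r r<x
  ; U-upper     = λ p<r x<p → ℚ.<-trans x<p p<r
  ; L-open      = λ p<x → let r , p<r , r<x = ℚ.<-dense p<x in r , p<r , r<x
  ; U-open      = λ x<r → let p , x<p , p<r = ℚ.<-dense x<r in p , p<r , x<p
  ; disjoint    = λ (p<x , x<p) → ℚ.<-asym p<x x<p
  ; located     = located
  }
  where
  x<x+1 : x ℚ.< x ℚ.+ 1ℚ
  x<x+1 = subst (ℚ._< x ℚ.+ 1ℚ) (ℚ.+-identityʳ x) (ℚ.+-monoʳ-< x (ℚ.positive⁻¹ 1ℚ))
  x-1<x : x ℚ.- 1ℚ ℚ.< x
  x-1<x = subst (x ℚ.- 1ℚ ℚ.<_) (ℚ.+-identityʳ x) (ℚ.+-monoʳ-< x (ℚ.negative⁻¹ (ℚ.- 1ℚ)))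
  located : ∀ {p r} → p ℚ.< r → _
  located {p} {r} p<r with p ℚ.<? x
  ... | yes p<x = inj₁ p<x
  ... | no  p≮x = inj₂ (ℚ.≤-<-trans (ℚ.≮⇒≥ p≮x) p<r)

-- With ε = e / s it suffices that s |b G − a N| < N, since then |G / N − a / b| < 1 / (s b) ≤ ε.
HasDensity⇒⟶ : ∀ (G : ℕ → ℤ) → HasDensity G → ∃ λ δ → (λ N → G N ℚ./ N) ⟶ fromℚ δ
HasDensity⇒⟶ G (a , suc b , _ , neg) = a ℚ./ suc b , limit
  where
  limit : (λ N → G N ℚ./ N) ⟶ fromℚ (a ℚ./ suc b)
  limit (mkℚ (+ zero) s cop) 0<ε with () ← ℚ.positive 0<ε
  limit (mkℚ (-[1+ _ ]) s cop) 0<ε with () ← ℚ.positive 0<ε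
  -- The factor 2 pays for the constant: once N > C, the bound N + C is strictly below 2 N. The
  -- denominator of ε is `suc s`.
  limit ε@(mkℚ (+ suc e) s cop) 0<ε with C , bound ← neg (2 ℕ.* suc s) = suc C , close
    where
    close : ∀ N .{{_ : NonZero N}} → suc C ≤ N →
      G N ℚ./ N ℚ.- ε ℚ.< a ℚ./ suc b × a ℚ./ suc b ℚ.< G N ℚ./ N ℚ.+ ε
    close (suc n) C<N = ℚ.toℚᵘ-cancel-< lower , ℚ.toℚᵘ-cancel-< upper
      where
      N : ℕ
      N = suc n
      D : ℤ
      D = + suc b * G N - a * + N
      s∣D∣<N : suc s ℕ.* ∣ D ∣ < N
      s∣D∣<N = ℕ.*-cancelˡ-< 2 _ _ (begin-strict
        2 ℕ.* (suc s ℕ.* ∣ D ∣) ≡⟨ ℕ.*-assoc 2 (suc s) ∣ D ∣ ⟨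
        2 ℕ.* suc s ℕ.* ∣ D ∣   ≤⟨ bound N ⟩
        N ℕ.+ C                 <⟨ ℕ.+-monoʳ-< N C<N ⟩
        N ℕ.+ N                 ≡⟨ cong (N ℕ.+_) (ℕ.+-identityʳ N) ⟨
        2 ℕ.* N                 ∎)
        where open ℕ.≤-Reasoning
      -- The lower bound takes `D` for `E`, the upper bound takes `- D`.
      small : ∀ E → ∣ E ∣ ≡ ∣ D ∣ → + suc s * E ℤ.< + suc e * + N * + suc b
      small E ∣E∣≡∣D∣ = begin-strict
        + suc s * E                  ≤⟨ i≤∣i∣ (+ suc s * E) ⟩
        + ∣ + suc s * E ∣            ≡⟨ cong +_ (trans (ℤ.abs-* (+ suc s) E) (cong (suc s ℕ.*_) ∣E∣≡∣D∣)) ⟩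
        + (suc s ℕ.* ∣ D ∣)          <⟨ ℤ.+<+ s∣D∣<N ⟩
        + N                          ≤⟨ ℤ.+≤+ (ℕ.m≤m+n N _) ⟩
        + (suc e ℕ.* N)              ≤⟨ ℤ.+≤+ (ℕ.m≤m*n (suc e ℕ.* N) (suc b)) ⟩
        + (suc e ℕ.* N ℕ.* suc b)    ≡⟨ ℤ.pos-* (suc e ℕ.* N) (suc b) ⟩
        + (suc e ℕ.* N) * + suc b    ≡⟨ cong (_* + suc b) (ℤ.pos-* (suc e) N) ⟩
        + suc e * + N * + suc b      ∎
        where
        open ℤ.≤-Reasoning
        i≤∣i∣ : ∀ i → i ℤ.≤ + ∣ i ∣
        i≤∣i∣ (+ _)      = ℤ.≤-refl
        i≤∣i∣ (-[1+ _ ]) = ℤ.-≤+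
      /ᵘ : ∀ i k → toℚᵘ (i ℚ./ suc k) ℚᵘ.≃ mkℚᵘ i k
      /ᵘ i k = ℚ.toℚᵘ-fromℚᵘ (mkℚᵘ i k)
      lower : toℚᵘ (G N ℚ./ N ℚ.- ε) ℚᵘ.< toℚᵘ (a ℚ./ suc b)
      lower = ℚᵘ.<-respˡ-≃ (ℚᵘ.≃-sym (ℚᵘ.≃-trans (ℚ.toℚᵘ-homo-+ (G N ℚ./ N) (ℚ.- ε))
          (ℚᵘ.+-congˡ (toℚᵘ (ℚ.- ε)) (/ᵘ (G N) n))))
        (ℚᵘ.<-respʳ-≃ (ℚᵘ.≃-sym (/ᵘ a b)) (ℚᵘ.*<* (subst₂ ℤ._<_
          (lemma (+ suc b) (G N) (+ suc s) a (+ N) (+ suc e))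
          (trans (lemma′ (+ suc s) a (+ N) (+ suc e) (+ suc b)) (cong (a *_) (sym (ℤ.pos-* N (suc s)))))
          (ℤ.+-monoˡ-< (+ suc s * (a * + N) - + suc e * + N * + suc b) (small D refl)))))
        where
        lemma : ∀ b g s a N e → s * (b * g - a * N) + (s * (a * N) - e * N * b)
          ≡ (g * s + - e * N) * b
        lemma = solve-∀
        lemma′ : ∀ s a N e b → e * N * b + (s * (a * N) - e * N * b) ≡ a * (N * s)
        lemma′ = solve-∀
      upper : toℚᵘ (a ℚ./ suc b) ℚᵘ.< toℚᵘ (G N ℚ./ N ℚ.+ ε)
      upper = ℚᵘ.<-respʳ-≃ (ℚᵘ.≃-sym (ℚᵘ.≃-trans (ℚ.toℚᵘ-homo-+ (G N ℚ./ N) ε)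
          (ℚᵘ.+-congˡ (toℚᵘ ε) (/ᵘ (G N) n))))
        (ℚᵘ.<-respˡ-≃ (ℚᵘ.≃-sym (/ᵘ a b)) (ℚᵘ.*<* (subst₂ ℤ._<_
          (trans (lemma (+ suc b) (G N) (+ suc s) a (+ N)) (cong (a *_) (sym (ℤ.pos-* N (suc s)))))
          (lemma′ (+ suc b) (G N) (+ suc s) (+ N) (+ suc e))
          (ℤ.+-monoˡ-< (+ suc s * (+ suc b * G N)) (small (- D) (ℤ.∣-i∣≡∣i∣ D))))))
        where
        lemma : ∀ b g s a N → s * (- (b * g - a * N)) + s * (b * g) ≡ a * (N * s)
        lemma = solve-∀
        lemma′ : ∀ b g s N e → e * N * b + s * (b * g) ≡ (g * s + e * N) * b
        lemma′ = solve-∀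

densityExists : ∀ q d s → HasDensity (Σ< λ n → ind d (form q s n)) → DensityExists q d s
densityExists q d s dens = fromℚ (proj₁ limit) , proj₂ limit
  where
  G : ℕ → ℤ
  G N = + γ N q d s
  limit : ∃ λ δ → (λ N → G N ℚ./ N) ⟶ fromℚ δ
  limit = HasDensity⇒⟶ G (HasDensity-cong {Σ< λ n → ind d (form q s n)} {G} (λ N → sym (γ-Σ< N q d s)) dens)

-- Recursions in base q

-- Cancelling one factor q matches the powers q^(j+1) dividing q n with the powers q^j dividing n.
v-* : ∀ {q} → 2 ≤ q → ∀ n .{{_ : NonZero n}} → v q (q ℕ.* n) ≡ suc (v q n)
v-* {q@(suc _)} 2≤q n = ℕ.≤-antisym
  (upper (v q (q ℕ.* n)) (v-divides q (q ℕ.* n)))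
  (v-max 2≤q (q ℕ.* n) (suc (v q n)) (ℕ.*-monoʳ-∣ q (v-divides q n)))
  where
  instance
    qn≢0 : NonZero (q ℕ.* n)
    qn≢0 = ℕ.m*n≢0 q n
  upper : ∀ k → q ^ k ℕ.∣ q ℕ.* n → k ≤ suc (v q n)
  upper zero    _ = z≤n
  upper (suc j) h = s≤s (v-max 2≤q n j (ℕ.*-cancelˡ-∣ q h))

-- A positive valuation would make q divide the remainder, which lies strictly between 0 and q.
v-*+ : ∀ q n {r} → suc r < q → v q (q ℕ.* n ℕ.+ suc r) ≡ 0
v-*+ q n {r} r<q with v q (q ℕ.* n ℕ.+ suc r) | v-divides q (q ℕ.* n ℕ.+ suc r)
... | zero  | _ = refl
... | suc k | h = contradiction
  (ℕ.∣⇒≤ (ℕ.∣m+n∣m⇒∣n (ℕ.∣-trans (ℕ.m∣m*n (q ^ k)) h) (ℕ.m∣m*n n))) (ℕ.<⇒≱ r<q)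

-- The multiple q (n + 1) follows the last element q n + p of the preceding block. This links the
-- two halves of the mutual inductions below.
*-suc-pred : ∀ p n → suc p ℕ.* suc n ≡ suc (suc p ℕ.* n ℕ.+ p)
*-suc-pred = ℕSolver.solve-∀

-- Only multiples of q contribute, and v(q i) = 1 + v(i) for i > 0, so summing over i ≤ n gives w(n)
-- + n. `w-*+` walks along a block, where w stays constant; `w-*` crosses to the next block.
w-*+ : ∀ {q} → 2 ≤ q → ∀ n r → r < q → w q (q ℕ.* n ℕ.+ r) ≡ w q n ℕ.+ n
w-* : ∀ {q} → 2 ≤ q → ∀ n → w q (q ℕ.* n) ≡ w q n ℕ.+ n

w-*+ {q} 2≤q n zero    _ = trans (cong (w q) (ℕ.+-identityʳ (q ℕ.* n))) (w-* 2≤q n)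
w-*+ {q} 2≤q n (suc r) r<q = begin
  w q (q ℕ.* n ℕ.+ suc r)                         ≡⟨ cong (w q) (ℕ.+-suc (q ℕ.* n) r) ⟩
  w q (q ℕ.* n ℕ.+ r) ℕ.+ v q (suc (q ℕ.* n ℕ.+ r))
    ≡⟨ cong₂ ℕ._+_ (w-*+ 2≤q n r (ℕ.<⇒≤ r<q)) (cong (v q) (sym (ℕ.+-suc (q ℕ.* n) r))) ⟩
  w q n ℕ.+ n ℕ.+ v q (q ℕ.* n ℕ.+ suc r)         ≡⟨ cong (w q n ℕ.+ n ℕ.+_) (v-*+ q n r<q) ⟩
  w q n ℕ.+ n ℕ.+ 0                               ≡⟨ ℕ.+-identityʳ _ ⟩
  w q n ℕ.+ n                                     ∎
  where open ≡-Reasoning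

w-* {q} 2≤q zero rewrite ℕ.*-zeroʳ q = refl
w-* {q@(suc p)} 2≤q (suc n) = begin
  w q (q ℕ.* suc n)                               ≡⟨ cong (w q) (*-suc-pred p n) ⟩
  w q (q ℕ.* n ℕ.+ p) ℕ.+ v q (suc (q ℕ.* n ℕ.+ p))
    ≡⟨ cong₂ ℕ._+_ (w-*+ 2≤q n p ℕ.≤-refl) (cong (v q) (sym (*-suc-pred p n))) ⟩
  w q n ℕ.+ n ℕ.+ v q (q ℕ.* suc n)               ≡⟨ cong (w q n ℕ.+ n ℕ.+_) (v-* 2≤q (suc n)) ⟩
  w q n ℕ.+ n ℕ.+ suc (v q (suc n))               ≡⟨ lemma (w q n) n (v q (suc n)) ⟩
  w q (suc n) ℕ.+ suc n                           ∎
  where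
  open ≡-Reasoning
  lemma : ∀ w n v → w ℕ.+ n ℕ.+ suc v ≡ w ℕ.+ v ℕ.+ suc n
  lemma = ℕSolver.solve-∀

-- Triangular numbers

triangle : ℕ → ℕ
triangle n = n ℕ.* suc n ℕ./ 2

triangle-suc : ∀ n → triangle (suc n) ≡ triangle n ℕ.+ suc n
triangle-suc n = begin
  suc n ℕ.* suc (suc n) ℕ./ 2                ≡⟨ cong (ℕ._/ 2) (lemma n) ⟩
  (n ℕ.* suc n ℕ.+ suc n ℕ.* 2) ℕ./ 2        ≡⟨ ℕ.+-distrib-/-∣ʳ (n ℕ.* suc n) (ℕ.n∣m*n (suc n)) ⟩
  triangle n ℕ.+ suc n ℕ.* 2 ℕ./ 2           ≡⟨ cong (triangle n ℕ.+_) (ℕ.m*n/n≡m (suc n) 2) ⟩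
  triangle n ℕ.+ suc n                       ∎
  where
  open ≡-Reasoning
  lemma : ∀ n → suc n ℕ.* suc (suc n) ≡ n ℕ.* suc n ℕ.+ suc n ℕ.* 2
  lemma = ℕSolver.solve-∀

2*triangle : ∀ n → 2 ℕ.* triangle n ≡ n ℕ.* suc n
2*triangle zero    = refl
2*triangle (suc n) = begin
  2 ℕ.* triangle (suc n)            ≡⟨ cong (2 ℕ.*_) (triangle-suc n) ⟩
  2 ℕ.* (triangle n ℕ.+ suc n)      ≡⟨ ℕ.*-distribˡ-+ 2 (triangle n) (suc n) ⟩
  2 ℕ.* triangle n ℕ.+ 2 ℕ.* suc n  ≡⟨ cong (ℕ._+ 2 ℕ.* suc n) (2*triangle n) ⟩
  n ℕ.* suc n ℕ.+ 2 ℕ.* suc n       ≡⟨ lemma n ⟩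
  suc n ℕ.* suc (suc n)             ∎
  where
  open ≡-Reasoning
  lemma : ∀ n → n ℕ.* suc n ℕ.+ 2 ℕ.* suc n ≡ suc n ℕ.* suc (suc n)
  lemma = ℕSolver.solve-∀

-- Both sides are moved so that no subtraction occurs.
triangle-*+ : ∀ p n r → triangle (suc p ℕ.* n ℕ.+ r) ℕ.+ triangle p ℕ.* n
  ≡ suc p ℕ.* suc p ℕ.* triangle n ℕ.+ suc p ℕ.* r ℕ.* n ℕ.+ triangle r
triangle-*+ p n r = ℕ.*-cancelˡ-≡ _ _ 2 (begin
  2 ℕ.* (triangle N ℕ.+ triangle p ℕ.* n)
    ≡⟨ lemma₁ (triangle N) (triangle p) n ⟩
  2 ℕ.* triangle N ℕ.+ 2 ℕ.* triangle p ℕ.* n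
    ≡⟨ cong₂ (λ x y → x ℕ.+ y ℕ.* n) (2*triangle N) (2*triangle p) ⟩
  N ℕ.* suc N ℕ.+ p ℕ.* suc p ℕ.* n
    ≡⟨ lemma₂ p n r ⟩
  suc p ℕ.* suc p ℕ.* (n ℕ.* suc n) ℕ.+ 2 ℕ.* (suc p ℕ.* r ℕ.* n) ℕ.+ r ℕ.* suc r
    ≡⟨ cong₂ (λ x y → suc p ℕ.* suc p ℕ.* x ℕ.+ 2 ℕ.* (suc p ℕ.* r ℕ.* n) ℕ.+ y)
         (2*triangle n) (2*triangle r) ⟨
  suc p ℕ.* suc p ℕ.* (2 ℕ.* triangle n) ℕ.+ 2 ℕ.* (suc p ℕ.* r ℕ.* n) ℕ.+ 2 ℕ.* triangle r
    ≡⟨ lemma₃ (suc p ℕ.* suc p) (triangle n) (suc p ℕ.* r ℕ.* n) (triangle r) ⟩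
  2 ℕ.* (suc p ℕ.* suc p ℕ.* triangle n ℕ.+ suc p ℕ.* r ℕ.* n ℕ.+ triangle r) ∎)
  where
  open ≡-Reasoning
  N : ℕ
  N = suc p ℕ.* n ℕ.+ r
  lemma₁ : ∀ x y n → 2 ℕ.* (x ℕ.+ y ℕ.* n) ≡ 2 ℕ.* x ℕ.+ 2 ℕ.* y ℕ.* n
  lemma₁ = ℕSolver.solve-∀
  lemma₂ : ∀ p n r → (suc p ℕ.* n ℕ.+ r) ℕ.* suc (suc p ℕ.* n ℕ.+ r) ℕ.+ p ℕ.* suc p ℕ.* n
    ≡ suc p ℕ.* suc p ℕ.* (n ℕ.* suc n) ℕ.+ 2 ℕ.* (suc p ℕ.* r ℕ.* n) ℕ.+ r ℕ.* suc r
  lemma₂ = ℕSolver.solve-∀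
  lemma₃ : ∀ x t y s → x ℕ.* (2 ℕ.* t) ℕ.+ 2 ℕ.* y ℕ.+ 2 ℕ.* s ≡ 2 ℕ.* (x ℕ.* t ℕ.+ y ℕ.+ s)
  lemma₃ = ℕSolver.solve-∀

-- On the block of i the function w has the constant value w(i) + i. Blocks 0 to n in full would
-- give q (u(n) + n(n+1)/2); the last block has only r + 1 of its q = p + 1 terms, so (p - r)(w(n) +
-- n) is to be subtracted. The part with p stands on the left to stay in ℕ.
u-*+ : ∀ {p} → 2 ≤ suc p → ∀ n r → r < suc p →
  u (suc p) (suc p ℕ.* n ℕ.+ r) ℕ.+ p ℕ.* (w (suc p) n ℕ.+ n)
    ≡ suc p ℕ.* u (suc p) n ℕ.+ suc p ℕ.* triangle n ℕ.+ r ℕ.* (w (suc p) n ℕ.+ n)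
u-* : ∀ {p} → 2 ≤ suc p → ∀ n →
  u (suc p) (suc p ℕ.* n) ℕ.+ p ℕ.* (w (suc p) n ℕ.+ n)
    ≡ suc p ℕ.* u (suc p) n ℕ.+ suc p ℕ.* triangle n

u-*+ {p} 2≤q n zero    _ = trans
  (cong (λ N → u (suc p) N ℕ.+ p ℕ.* (w (suc p) n ℕ.+ n)) (ℕ.+-identityʳ (suc p ℕ.* n)))
  (trans (u-* 2≤q n) (sym (ℕ.+-identityʳ _)))
u-*+ {p} 2≤q n (suc r) r<p = begin
  u q (q ℕ.* n ℕ.+ suc r) ℕ.+ p ℕ.* W
    ≡⟨ cong (λ N → u q N ℕ.+ p ℕ.* W) (ℕ.+-suc (q ℕ.* n) r) ⟩
  u q (q ℕ.* n ℕ.+ r) ℕ.+ w q (suc (q ℕ.* n ℕ.+ r)) ℕ.+ p ℕ.* W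
    ≡⟨ cong (λ x → u q (q ℕ.* n ℕ.+ r) ℕ.+ x ℕ.+ p ℕ.* W)
         (trans (cong (w q) (sym (ℕ.+-suc (q ℕ.* n) r))) (w-*+ 2≤q n (suc r) r<p)) ⟩
  u q (q ℕ.* n ℕ.+ r) ℕ.+ W ℕ.+ p ℕ.* W
    ≡⟨ lemma₁ (u q (q ℕ.* n ℕ.+ r)) W (p ℕ.* W) ⟩
  u q (q ℕ.* n ℕ.+ r) ℕ.+ p ℕ.* W ℕ.+ W
    ≡⟨ cong (ℕ._+ W) (u-*+ 2≤q n r (ℕ.<⇒≤ r<p)) ⟩
  q ℕ.* u q n ℕ.+ q ℕ.* triangle n ℕ.+ r ℕ.* W ℕ.+ W
    ≡⟨ lemma₂ (q ℕ.* u q n ℕ.+ q ℕ.* triangle n) r W ⟩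
  q ℕ.* u q n ℕ.+ q ℕ.* triangle n ℕ.+ suc r ℕ.* W ∎
  where
  open ≡-Reasoning
  q W : ℕ
  q = suc p
  W = w q n ℕ.+ n
  lemma₁ : ∀ x y z → x ℕ.+ y ℕ.+ z ≡ x ℕ.+ z ℕ.+ y
  lemma₁ = ℕSolver.solve-∀
  lemma₂ : ∀ x r W → x ℕ.+ r ℕ.* W ℕ.+ W ≡ x ℕ.+ suc r ℕ.* W
  lemma₂ = ℕSolver.solve-∀

u-* {p} 2≤q zero rewrite ℕ.*-zeroʳ p = refl
u-* {p} 2≤q (suc n) = begin
  u q (q ℕ.* suc n) ℕ.+ p ℕ.* W′
    ≡⟨ cong (λ N → u q N ℕ.+ p ℕ.* W′) (*-suc-pred p n) ⟩
  u q (q ℕ.* n ℕ.+ p) ℕ.+ w q (suc (q ℕ.* n ℕ.+ p)) ℕ.+ p ℕ.* W′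
    ≡⟨ cong₂ (λ x y → x ℕ.+ y ℕ.+ p ℕ.* W′)
         {u q (q ℕ.* n ℕ.+ p)} {q ℕ.* u q n ℕ.+ q ℕ.* triangle n} {w q (suc (q ℕ.* n ℕ.+ p))} {W′}
         (ℕ.+-cancelʳ-≡ (p ℕ.* (w q n ℕ.+ n)) (u q (q ℕ.* n ℕ.+ p)) (q ℕ.* u q n ℕ.+ q ℕ.* triangle n)
           (u-*+ 2≤q n p ℕ.≤-refl))
         (trans (cong (w q) (sym (*-suc-pred p n))) (w-* 2≤q (suc n))) ⟩
  q ℕ.* u q n ℕ.+ q ℕ.* triangle n ℕ.+ W′ ℕ.+ p ℕ.* W′
    ≡⟨ lemma p (u q n) (triangle n) (w q (suc n)) n ⟩
  q ℕ.* u q (suc n) ℕ.+ q ℕ.* (triangle n ℕ.+ suc n)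
    ≡⟨ cong (λ x → q ℕ.* u q (suc n) ℕ.+ q ℕ.* x) (triangle-suc n) ⟨
  q ℕ.* u q (suc n) ℕ.+ q ℕ.* triangle (suc n) ∎
  where
  open ≡-Reasoning
  q W′ : ℕ
  q = suc p
  W′ = w q (suc n) ℕ.+ suc n
  lemma : ∀ p u t w n → suc p ℕ.* u ℕ.+ suc p ℕ.* t ℕ.+ (w ℕ.+ suc n) ℕ.+ p ℕ.* (w ℕ.+ suc n)
    ≡ suc p ℕ.* (u ℕ.+ w) ℕ.+ suc p ℕ.* (t ℕ.+ suc n)
  lemma = ℕSolver.solve-∀

-- The coefficients, as a form in m, after the substitution n = q m + r with q = p + 1.
next : ℕ → ℕ → ℤ⁵ → ℤ⁵
next p r (θu , θw , θ₂ , θ₁ , θ₀) =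
  q * θu ,
  θw + (+ r - + p) * θu ,
  q * θu + q * q * θ₂ ,
  (+ r - + p) * θu + θw + (q * + r - + triangle p) * θ₂ + q * θ₁ ,
  + triangle r * θ₂ + + r * θ₁ + θ₀
  where
  q : ℤ
  q = + suc p

form-*+ : ∀ {p} → 2 ≤ suc p → ∀ s n r → r < suc p →
  form (suc p) s (suc p ℕ.* n ℕ.+ r) ≡ form (suc p) (next p r s) n
form-*+ {p} 2≤q s@(θu , θw , θ₂ , θ₁ , θ₀) n r r<q = begin
  θu * + u q N + θw * + w q N + θ₂ * + triangle N + θ₁ * + N + θ₀
    ≡⟨ expand (+ u q N) U (+ w q N) W (+ triangle N) T (+ N) (+ q * + n + + r) ueq weq Teq Neq ⟩
  θu * U + θw * W + θ₂ * T + θ₁ * (+ q * + n + + r) + θ₀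
    ≡⟨ lemma θu θw θ₂ θ₁ θ₀ (+ q) (+ p) (+ n) (+ r)
         (+ u q n) (+ w q n) (+ triangle n) (+ triangle p) (+ triangle r) ⟩
  form q (next p r s) n ∎
  where
  open ≡-Reasoning
  q N : ℕ
  q = suc p
  N = q ℕ.* n ℕ.+ r
  U W T : ℤ
  W = + w q n + + n
  U = + q * + u q n + + q * + triangle n + + r * W - + p * W
  T = + q * + q * + triangle n + + q * + r * + n + + triangle r - + triangle p * + n
  expand : ∀ a a′ b b′ c c′ e e′ → a ≡ a′ → b ≡ b′ → c ≡ c′ → e ≡ e′ →
    θu * a + θw * b + θ₂ * c + θ₁ * e + θ₀ ≡ θu * a′ + θw * b′ + θ₂ * c′ + θ₁ * e′ + θ₀
  expand _ _ _ _ _ _ _ _ refl refl refl refl = refl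
  Neq : + N ≡ + q * + n + + r
  Neq = trans (ℤ.pos-+ (q ℕ.* n) r) (cong (_+ + r) (ℤ.pos-* q n))
  weq : + w q N ≡ W
  weq = trans (cong +_ (w-*+ 2≤q n r r<q)) (ℤ.pos-+ (w q n) n)
  move : ∀ {x y z} → x + y ≡ z → x ≡ z - y
  move {x} {y} refl = shift x y
    where
    shift : ∀ x y → x ≡ x + y - y
    shift = solve-∀
  posW : ∀ k → + (k ℕ.* (w q n ℕ.+ n)) ≡ + k * W
  posW k = trans (ℤ.pos-* k (w q n ℕ.+ n)) (cong (+ k *_) (ℤ.pos-+ (w q n) n))
  ueq : + u q N ≡ U
  ueq = move (begin
    + u q N + + p * W
      ≡⟨ cong (λ z → + u q N + z) (posW p) ⟨
    + u q N + + (p ℕ.* (w q n ℕ.+ n))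
      ≡⟨ ℤ.pos-+ (u q N) (p ℕ.* (w q n ℕ.+ n)) ⟨
    + (u q N ℕ.+ p ℕ.* (w q n ℕ.+ n))
      ≡⟨ cong +_ (u-*+ 2≤q n r r<q) ⟩
    + (q ℕ.* u q n ℕ.+ q ℕ.* triangle n ℕ.+ r ℕ.* (w q n ℕ.+ n))
      ≡⟨ ℤ.pos-+ (q ℕ.* u q n ℕ.+ q ℕ.* triangle n) (r ℕ.* (w q n ℕ.+ n)) ⟩
    + (q ℕ.* u q n ℕ.+ q ℕ.* triangle n) + + (r ℕ.* (w q n ℕ.+ n))
      ≡⟨ cong₂ _+_ (trans (ℤ.pos-+ (q ℕ.* u q n) (q ℕ.* triangle n))
           (cong₂ _+_ (ℤ.pos-* q (u q n)) (ℤ.pos-* q (triangle n)))) (posW r) ⟩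
    + q * + u q n + + q * + triangle n + + r * W ∎)
  Teq : + triangle N ≡ T
  Teq = move (begin
    + triangle N + + triangle p * + n
      ≡⟨ cong (λ z → + triangle N + z) (ℤ.pos-* (triangle p) n) ⟨
    + triangle N + + (triangle p ℕ.* n)
      ≡⟨ ℤ.pos-+ (triangle N) (triangle p ℕ.* n) ⟨
    + (triangle N ℕ.+ triangle p ℕ.* n)
      ≡⟨ cong +_ (triangle-*+ p n r) ⟩
    + (q ℕ.* q ℕ.* triangle n ℕ.+ q ℕ.* r ℕ.* n ℕ.+ triangle r)
      ≡⟨ ℤ.pos-+ (q ℕ.* q ℕ.* triangle n ℕ.+ q ℕ.* r ℕ.* n) (triangle r) ⟩
    + (q ℕ.* q ℕ.* triangle n ℕ.+ q ℕ.* r ℕ.* n) + + triangle r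
      ≡⟨ cong (_+ + triangle r) (trans (ℤ.pos-+ (q ℕ.* q ℕ.* triangle n) (q ℕ.* r ℕ.* n))
           (cong₂ _+_ (pos-** q q (triangle n)) (pos-** q r n))) ⟩
    + q * + q * + triangle n + + q * + r * + n + + triangle r ∎)
    where
    pos-** : ∀ a b c → + (a ℕ.* b ℕ.* c) ≡ + a * + b * + c
    pos-** a b c = trans (ℤ.pos-* (a ℕ.* b) c) (cong (_* + c) (ℤ.pos-* a b))
  lemma : ∀ θu θw θ₂ θ₁ θ₀ q p n r u w t tp tr →
    θu * (q * u + q * t + r * (w + n) - p * (w + n)) + θw * (w + n)
      + θ₂ * (q * q * t + q * r * n + tr - tp * n) + θ₁ * (q * n + r) + θ₀
    ≡ q * θu * u + (θw + (r - p) * θu) * w + (q * θu + q * q * θ₂) * t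
      + ((r - p) * θu + θw + (q * r - tp) * θ₂ + q * θ₁) * n + (tr * θ₂ + r * θ₁ + θ₀)
  lemma = solve-∀

-- Equidistribution of q-additive sequences

-- Bernoulli's inequality 1 + i / p ≤ (1 + 1 / p)^i, cleared of denominators.
bernoulli : ∀ p i → p ^ i ℕ.* (p ℕ.+ i) ≤ suc p ^ i ℕ.* p
bernoulli p zero    = ℕ.≤-reflexive (cong (1 ℕ.*_) (ℕ.+-identityʳ p))
bernoulli p (suc i) = begin
  p ^ suc i ℕ.* (p ℕ.+ suc i)        ≤⟨ ℕ.m≤m+n _ (p ^ i ℕ.* i) ⟩
  p ^ suc i ℕ.* (p ℕ.+ suc i) ℕ.+ p ^ i ℕ.* i ≡⟨ lemma p i (p ^ i) ⟩
  suc p ℕ.* (p ^ i ℕ.* (p ℕ.+ i))    ≤⟨ ℕ.*-monoʳ-≤ (suc p) (bernoulli p i) ⟩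
  suc p ℕ.* (suc p ^ i ℕ.* p)        ≡⟨ ℕ.*-assoc (suc p) (suc p ^ i) p ⟨
  suc p ^ suc i ℕ.* p                ∎
  where
  open ℕ.≤-Reasoning
  lemma : ∀ p i x → p ℕ.* x ℕ.* (p ℕ.+ suc i) ℕ.+ x ℕ.* i ≡ suc p ℕ.* (x ℕ.* (p ℕ.+ i))
  lemma = ℕSolver.solve-∀

-- For p > 0 the exponent i = m p makes the Bernoulli bound 1 + i / p equal to 1 + m. For p = 0 the
-- exponent must be positive, as 0^0 = 1.
^-dominates : ∀ m p → ∃ λ i → m ℕ.* p ^ i ≤ suc p ^ i
^-dominates m zero      = 1 , subst (_≤ 1) (sym (ℕ.*-zeroʳ m)) z≤n
^-dominates m p@(suc _) = i , ℕ.*-cancelʳ-≤ _ _ p (begin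
  m ℕ.* p ^ i ℕ.* p                 ≤⟨ ℕ.m≤n+m _ (p ^ i ℕ.* p) ⟩
  p ^ i ℕ.* p ℕ.+ m ℕ.* p ^ i ℕ.* p ≡⟨ lemma (p ^ i) p m ⟩
  p ^ i ℕ.* (p ℕ.+ m ℕ.* p)         ≤⟨ bernoulli p i ⟩
  suc p ^ i ℕ.* p                   ∎)
  where
  open ℕ.≤-Reasoning
  i = m ℕ.* p
  lemma : ∀ x p m → x ℕ.* p ℕ.+ m ℕ.* x ℕ.* p ≡ x ℕ.* (p ℕ.+ m ℕ.* p)
  lemma = ℕSolver.solve-∀

-- Strong K-additivity modulo d: for K ≥ 2, f(n) is congruent to the sum of f over the base K digits
-- of n.
Additive : ℕ → ℕ → (ℕ → ℤ) → Set
Additive d K f = ∀ n m → m < K → f (K ℕ.* n ℕ.+ m) ≡ f n + f m [mod d ]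

-- The lowest base K digit m₀ of m is split off, the induction hypothesis handles the rest m₁, and
-- additivity applied to m itself reassembles f(m₁) + f(m₀) into f(m).
Additive-^ : ∀ {d K f} .{{_ : NonZero K}} → f 0 ≡ 0ℤ → Additive d K f → ∀ i → Additive d (K ^ i) f
Additive-^ {f = f} f0 add zero n zero m<1 =
  ≡⇒≡mod (trans (cong f (trans (ℕ.+-identityʳ (1 ℕ.* n)) (ℕ.*-identityˡ n)))
    (sym (trans (cong (λ z → f n + z) f0) (ℤ.+-identityʳ (f n)))))
Additive-^ f0 add zero n (suc _) (s≤s ())
Additive-^ {d} {K} {f} f0 add (suc i) n m m<K^1+i =
  subst (λ k → f k ≡ f n + f m [mod d ]) (sym regroup)
    (mod-trans (add (K ^ i ℕ.* n ℕ.+ m₁) m₀ m₀<K)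
      (mod-trans (mod-+ (Additive-^ {f = f} f0 add i n m₁ m₁<K^i) (mod-refl (f m₀)))
        (subst (_≡ f n + f m [mod d ]) (sym (ℤ.+-assoc (f n) (f m₁) (f m₀)))
          (mod-+ (mod-refl (f n))
            (mod-sym (subst (λ k → f k ≡ f m₁ + f m₀ [mod d ]) (sym (divMod K m))
              (add m₁ m₀ m₀<K)))))))
  where
  m₀ m₁ : ℕ
  m₀ = m ℕ.% K
  m₁ = m ℕ./ K
  m₀<K : m₀ < K
  m₀<K = ℕ.m%n<n m K
  m₁<K^i : m₁ < K ^ i
  m₁<K^i = ℕ.m<n*o⇒m/o<n (subst (m <_) (ℕ.*-comm K (K ^ i)) m<K^1+i)
  regroup : K ^ suc i ℕ.* n ℕ.+ m ≡ K ℕ.* (K ^ i ℕ.* n ℕ.+ m₁) ℕ.+ m₀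
  regroup = trans (cong (K ^ suc i ℕ.* n ℕ.+_) (divMod K m)) (lemma K (K ^ i) n m₁ m₀)
    where
    lemma : ∀ K x n m₁ m₀ → K ℕ.* x ℕ.* n ℕ.+ (K ℕ.* m₁ ℕ.+ m₀) ≡ K ℕ.* (x ℕ.* n ℕ.+ m₁) ℕ.+ m₀
    lemma = ℕSolver.solve-∀

module Equidistribution
  (d : ℕ) .{{_ : NonZero d}} (p : ℕ) (f : ℕ → ℤ) (additive : Additive d (suc p) f)
  (covering : ∀ x → ∃ λ m → m < suc p × f m ≡ x [mod d ])
  where

  K : ℕ
  K = suc p

  F : ℕ → ℤ → ℤ
  F N t = Σ< (λ n → + d * ind d (f n + t) - 1ℤ) N

  F-periodic : ∀ N → Periodic d (F N)
  F-periodic N {x} {y} x≡y = Σ<-cong N λ n _ → cong (λ z → + d * z - 1ℤ)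
    (ind-mod (mod-+ (mod-refl (f n)) x≡y))

  -- For each n exactly one of the d shifts makes f(n) + t + x divisible by d, so the terms
  -- belonging to n add up to d - d = 0.
  F-residues : ∀ N t → Σ< (λ x → F N (t + + x)) d ≡ 0ℤ
  F-residues N t = trans (Σ<-swap (λ x n → + d * ind d (f n + (t + + x)) - 1ℤ) d N)
    (Σ<-zero N λ n _ → begin
      Σ< (λ x → + d * ind d (f n + (t + + x)) - 1ℤ) d
        ≡⟨ Σ<-+ (λ x → + d * ind d (f n + (t + + x))) (λ _ → - 1ℤ) d ⟩
      Σ< (λ x → + d * ind d (f n + (t + + x))) d + Σ< (λ _ → - 1ℤ) d
        ≡⟨ cong₂ _+_ (Σ<-*ˡ (+ d) (λ x → ind d (f n + (t + + x))) d) (Σ<-const (- 1ℤ) d) ⟩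
      + d * Σ< (λ x → ind d (f n + (t + + x))) d + + d * - 1ℤ
        ≡⟨ cong (λ z → + d * z + + d * - 1ℤ)
             (trans (Σ<-cong d λ x _ → flip n (+ x)) (Σ<-ind-residues d (- (f n + t)))) ⟩
      + d * 1ℤ + + d * - 1ℤ
        ≡⟨ lemma (+ d) ⟩
      0ℤ ∎)
    where
    open ≡-Reasoning
    lemma : ∀ d → d * 1ℤ + d * - 1ℤ ≡ 0ℤ
    lemma = solve-∀
    -- Negation brings the argument into the shape y - x of `Σ<-ind-residues`.
    flip : ∀ n x → ind d (f n + (t + x)) ≡ ind d (- (f n + t) - x)
    flip n x = ind-cong
      (λ h → subst (+ d ∣_) (l₁ (f n) t x) (∣m⇒∣-m h))
      (λ h → subst (+ d ∣_) (l₂ (f n) t x) (∣m⇒∣-m h))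
      where
      l₁ : ∀ a t x → - (a + (t + x)) ≡ - (a + t) - x
      l₁ = solve-∀
      l₂ : ∀ a t x → - (- (a + t) - x) ≡ a + (t + x)
      l₂ = solve-∀

  -- With the summation index written as K n + m, additivity turns the last digit m into a shift of
  -- t by f(m).
  F-* : ∀ N t → F (K ℕ.* N) t ≡ Σ< (λ m → F N (t + f m)) K
  F-* N t = trans (Σ<-block (λ n → + d * ind d (f n + t) - 1ℤ) K N)
    (Σ<-cong K λ m m<K → Σ<-cong N λ n _ → cong (λ z → + d * z - 1ℤ)
      (trans (ind-mod (mod-+ (additive n m m<K) (mod-refl t)))
        (cong (ind d) (lemma (f n) (f m) t))))
    where
    lemma : ∀ a b t → a + b + t ≡ a + (t + b)
    lemma = solve-∀

  multiplicity : ℕ → ℤ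
  multiplicity x = Σ< (λ m → ind d (f m - + x)) K

  1≤multiplicity : ∀ x → 1ℤ ℤ.≤ multiplicity x
  1≤multiplicity x with m , m<K , fm≡x ← covering (+ x) =
    subst (ℤ._≤ multiplicity x) (ind-yes (difference fm≡x))
      (term≤Σ< (λ m → ind d (f m - + x)) m m<K λ m _ → 0≤ind d (f m - + x))

  Σ<-multiplicity : Σ< multiplicity d ≡ + K
  Σ<-multiplicity = begin
    Σ< multiplicity d ≡⟨ Σ<-swap (λ x m → ind d (f m - + x)) d K ⟩
    Σ< (λ m → Σ< (λ x → ind d (f m - + x)) d) K ≡⟨ Σ<-cong K (λ m _ → Σ<-ind-residues d (f m)) ⟩
    Σ< (λ _ → 1ℤ) K ≡⟨ trans (Σ<-const 1ℤ K) (ℤ.*-identityʳ (+ K)) ⟩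
    + K ∎
    where open ≡-Reasoning

  -- Since the F N (t + x) sum to zero over the residues x, one copy of each may be
  -- removed from the sum F-*; this is what makes the recursion contract.
  F-*-multiplicity : ∀ N t →
    F (K ℕ.* N) t ≡ Σ< (λ x → (multiplicity x - 1ℤ) * F N (t + + x)) d
  F-*-multiplicity N t = begin
    F (K ℕ.* N) t
      ≡⟨ F-* N t ⟩
    Σ< (λ m → G (f m)) K
      ≡⟨ Σ<-cong K (λ m _ → sym (Σ<-residues d G G-periodic (f m))) ⟩
    Σ< (λ m → Σ< (λ x → ind d (f m - + x) * G (+ x)) d) K
      ≡⟨ Σ<-swap (λ m x → ind d (f m - + x) * G (+ x)) K d ⟩
    Σ< (λ x → Σ< (λ m → ind d (f m - + x) * G (+ x)) K) d
      ≡⟨ Σ<-cong d (λ x _ → factor x) ⟩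
    Σ< (λ x → (multiplicity x - 1ℤ) * G (+ x) + G (+ x)) d
      ≡⟨ Σ<-+ (λ x → (multiplicity x - 1ℤ) * G (+ x)) (λ x → G (+ x)) d ⟩
    Σ< (λ x → (multiplicity x - 1ℤ) * G (+ x)) d + Σ< (λ x → G (+ x)) d
      ≡⟨ cong (λ z → Σ< (λ x → (multiplicity x - 1ℤ) * G (+ x)) d + z) (F-residues N t) ⟩
    Σ< (λ x → (multiplicity x - 1ℤ) * G (+ x)) d + 0ℤ
      ≡⟨ ℤ.+-identityʳ _ ⟩
    Σ< (λ x → (multiplicity x - 1ℤ) * G (+ x)) d ∎
    where
    open ≡-Reasoning
    G : ℤ → ℤ
    G y = F N (t + y)
    G-periodic : Periodic d G
    G-periodic {x} {y} x≡y = F-periodic N (mod-+ (mod-refl t) x≡y)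
    factor : ∀ x → Σ< (λ m → ind d (f m - + x) * G (+ x)) K ≡ (multiplicity x - 1ℤ) * G (+ x) + G (+ x)
    factor x = begin
      Σ< (λ m → ind d (f m - + x) * G (+ x)) K
        ≡⟨ Σ<-cong K (λ m _ → ℤ.*-comm (ind d (f m - + x)) (G (+ x))) ⟩
      Σ< (λ m → G (+ x) * ind d (f m - + x)) K
        ≡⟨ Σ<-*ˡ (G (+ x)) (λ m → ind d (f m - + x)) K ⟩
      G (+ x) * multiplicity x
        ≡⟨ lemma (G (+ x)) (multiplicity x) ⟩
      (multiplicity x - 1ℤ) * G (+ x) + G (+ x) ∎
      where
      lemma : ∀ g e → g * e ≡ (e - 1ℤ) * g + g
      lemma = solve-∀

  private
    D : ℕ
    D = suc d

  ∣discrepancy-term∣≤ : ∀ x → ∣ + d * ind d x - 1ℤ ∣ ≤ D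
  ∣discrepancy-term∣≤ x = begin
    ∣ + d * ind d x - 1ℤ ∣       ≤⟨ ℤ.∣i-j∣≤∣i∣+∣j∣ (+ d * ind d x) 1ℤ ⟩
    ∣ + d * ind d x ∣ ℕ.+ 1      ≡⟨ cong (ℕ._+ 1) (ℤ.abs-* (+ d) (ind d x)) ⟩
    d ℕ.* ∣ ind d x ∣ ℕ.+ 1      ≤⟨ ℕ.+-monoˡ-≤ 1 (ℕ.*-monoʳ-≤ d (∣ind∣≤1 d x)) ⟩
    d ℕ.* 1 ℕ.+ 1                ≡⟨ trans (cong (ℕ._+ 1) (ℕ.*-identityʳ d)) (ℕ.+-comm d 1) ⟩
    D                            ∎
    where open ℕ.≤-Reasoning

  -- The weights in `F-*-multiplicity` are nonnegative because every class is hit, and they total K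
  -- - d ≤ K - 1 = p. Bounding `F-*` directly would give the factor K and no gain.
  F-contracts : ∀ N B → (∀ t → ∣ F N t ∣ ≤ B) → ∀ t → ∣ F (K ℕ.* N) t ∣ ≤ p ℕ.* B
  F-contracts N B bound t = ℤ.drop‿+≤+ (begin
    + ∣ F (K ℕ.* N) t ∣
      ≡⟨ cong (λ z → + ∣ z ∣) (F-*-multiplicity N t) ⟩
    + ∣ Σ< (λ x → (multiplicity x - 1ℤ) * F N (t + + x)) d ∣
      ≤⟨ ∣Σ<-weighted∣≤ (λ x → multiplicity x - 1ℤ) (λ x → F N (t + + x)) d B
           (λ x → ℤ.i≤j⇒0≤j-i (1≤multiplicity x)) (λ x → bound (t + + x)) ⟩
    Σ< (λ x → multiplicity x - 1ℤ) d * + B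
      ≡⟨ cong (_* + B) (trans (Σ<-+ multiplicity (λ _ → - 1ℤ) d)
           (cong₂ _+_ Σ<-multiplicity (Σ<-const (- 1ℤ) d))) ⟩
    (+ K + + d * - 1ℤ) * + B
      ≤⟨ ℤ.*-monoʳ-≤-nonNeg (+ B) K-d≤p ⟩
    + p * + B
      ≡⟨ ℤ.pos-* p B ⟨
    + (p ℕ.* B) ∎)
    where
    open ℤ.≤-Reasoning
    lemma : ∀ p d → 1ℤ + p + d * - 1ℤ ≡ p + (1ℤ - d)
    lemma = solve-∀
    K-d≤p : + K + + d * - 1ℤ ℤ.≤ + p
    K-d≤p = begin
      + K + + d * - 1ℤ     ≡⟨ cong (_+ + d * - 1ℤ) (ℤ.pos-+ 1 p) ⟩
      1ℤ + + p + + d * - 1ℤ ≡⟨ lemma (+ p) (+ d) ⟩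
      + p + (1ℤ - + d)     ≤⟨ ℤ.+-monoʳ-≤ (+ p) (ℤ.i≤j⇒i-j≤0 (ℤ.+≤+ (ℕ.>-nonZero⁻¹ d))) ⟩
      + p + 0ℤ             ≡⟨ ℤ.+-identityʳ (+ p) ⟩
      + p                  ∎

  ∣F-^∣≤ : ∀ i N t → ∣ F (K ^ i ℕ.* N) t ∣ ≤ p ^ i ℕ.* (N ℕ.* D)
  ∣F-^∣≤ zero    N t rewrite ℕ.*-identityˡ N | ℕ.+-identityʳ (N ℕ.* D) =
    ∣Σ<∣≤ _ N D λ n _ → ∣discrepancy-term∣≤ (f n + t)
  ∣F-^∣≤ (suc i) N t rewrite ℕ.*-assoc K (K ^ i) N | ℕ.*-assoc p (p ^ i) (N ℕ.* D) =
    F-contracts (K ^ i ℕ.* N) _ (∣F-^∣≤ i N) t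

  -- Up to the multiple L M of L = K^i the discrepancy is at most p^i M D. With i chosen so that m D
  -- p^i ≤ K^i, m times this is at most L M ≤ N; the fewer than L remaining terms contribute a
  -- constant.
  F-negligible : ∀ t → Negligible (λ N → F N t)
  F-negligible t m with i , mDp^i≤K^i ← ^-dominates (m ℕ.* D) p = m ℕ.* (L ℕ.* D) , bound
    where
    L : ℕ
    L = K ^ i
    instance
      L≢0 : NonZero L
      L≢0 = ℕ.m^n≢0 K i
    bound : ∀ N → m ℕ.* ∣ F N t ∣ ≤ N ℕ.+ m ℕ.* (L ℕ.* D)
    bound N = begin
      m ℕ.* ∣ F N t ∣
        ≡⟨ cong (λ n → m ℕ.* ∣ F n t ∣) (divMod L N) ⟩
      m ℕ.* ∣ F (L ℕ.* M ℕ.+ ρ) t ∣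
        ≡⟨ cong (λ z → m ℕ.* ∣ z ∣) (Σ<-split term (L ℕ.* M) ρ) ⟩
      m ℕ.* ∣ F (L ℕ.* M) t + Σ< (λ j → term (L ℕ.* M ℕ.+ j)) ρ ∣
        ≤⟨ ℕ.*-monoʳ-≤ m (ℤ.∣i+j∣≤∣i∣+∣j∣ (F (L ℕ.* M) t) _) ⟩
      m ℕ.* (∣ F (L ℕ.* M) t ∣ ℕ.+ ∣ Σ< (λ j → term (L ℕ.* M ℕ.+ j)) ρ ∣)
        ≤⟨ ℕ.*-monoʳ-≤ m (ℕ.+-mono-≤ (∣F-^∣≤ i M t) tail) ⟩
      m ℕ.* (p ^ i ℕ.* (M ℕ.* D) ℕ.+ L ℕ.* D)
        ≡⟨ lemma m (p ^ i) M D (L ℕ.* D) ⟩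
      m ℕ.* D ℕ.* p ^ i ℕ.* M ℕ.+ m ℕ.* (L ℕ.* D)
        ≤⟨ ℕ.+-monoˡ-≤ _ (ℕ.*-monoˡ-≤ M mDp^i≤K^i) ⟩
      L ℕ.* M ℕ.+ m ℕ.* (L ℕ.* D)
        ≤⟨ ℕ.+-monoˡ-≤ _ (subst (L ℕ.* M ≤_) (sym (divMod L N)) (ℕ.m≤m+n (L ℕ.* M) ρ)) ⟩
      N ℕ.+ m ℕ.* (L ℕ.* D) ∎
      where
      open ℕ.≤-Reasoning
      term : ℕ → ℤ
      term n = + d * ind d (f n + t) - 1ℤ
      M ρ : ℕ
      M = N ℕ./ L
      ρ = N ℕ.% L
      tail : ∣ Σ< (λ j → term (L ℕ.* M ℕ.+ j)) ρ ∣ ≤ L ℕ.* D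
      tail = ℕ.≤-trans (∣Σ<∣≤ _ ρ D λ _ _ → ∣discrepancy-term∣≤ _)
        (ℕ.*-monoˡ-≤ D (ℕ.<⇒≤ (ℕ.m%n<n N L)))
      lemma : ∀ m x M D y → m ℕ.* (x ℕ.* (M ℕ.* D) ℕ.+ y) ≡ m ℕ.* D ℕ.* x ℕ.* M ℕ.+ m ℕ.* y
      lemma = ℕSolver.solve-∀

  equidistributed : ∀ t → HasDensity (Σ< λ n → ind d (f n + t))
  equidistributed t = 1ℤ , d , it , Negligible-cong unfold (F-negligible t)
    where
    it : NonZero d
    it = ℕ.>-nonZero (ℕ.>-nonZero⁻¹ d)
    unfold : ∀ N → F N t ≡ + d * Σ< (λ n → ind d (f n + t)) N - 1ℤ * + N
    unfold N = trans (Σ<-+ (λ n → + d * ind d (f n + t)) (λ _ → - 1ℤ) N)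
      (cong₂ _+_ (Σ<-*ˡ (+ d) (λ n → ind d (f n + t)) N) (trans (Σ<-const (- 1ℤ) N) (lemma (+ N))))
      where
      lemma : ∀ n → n * - 1ℤ ≡ - (1ℤ * n)
      lemma = solve-∀

-- Density of the linear forms

linear : ℕ → ℤ → ℤ → ℕ → ℤ
linear q θ c n = θ * + w q n + c * + n

-- The coefficient of n after k substitutions of q n + r for n: by `linear-*+` each of them keeps θ
-- and replaces c by θ + q c.
orbit : ℕ → ℤ → ℕ → ℤ → ℤ
orbit q θ zero    c = c
orbit q θ (suc k) c = orbit q θ k (θ + + q * c)

orbit-+ : ∀ q θ j k c → orbit q θ (j ℕ.+ k) c ≡ orbit q θ k (orbit q θ j c)
orbit-+ q θ zero    k c = refl
orbit-+ q θ (suc j) k c = orbit-+ q θ j k (θ + + q * c)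

-- The map is homogeneous in θ and c jointly; this lets a period modulo d h be divided by h.
orbit-*ʳ : ∀ q θ k c h → orbit q (θ * h) k (c * h) ≡ orbit q θ k c * h
orbit-*ʳ q θ zero    c h = refl
orbit-*ʳ q θ (suc k) c h = trans (cong (orbit q (θ * h) k) (lemma θ (+ q) c h))
  (orbit-*ʳ q θ k (θ + + q * c) h)
  where
  lemma : ∀ θ q c h → θ * h + q * (c * h) ≡ (θ + q * c) * h
  lemma = solve-∀

linear-*+ : ∀ {q} → 2 ≤ q → ∀ θ c n r → r < q →
  linear q θ c (q ℕ.* n ℕ.+ r) ≡ linear q θ (θ + + q * c) n + + r * c
linear-*+ {q} 2≤q θ c n r r<q = trans
  (cong₂ (λ x y → θ * x + c * y)
    (trans (cong +_ (w-*+ 2≤q n r r<q)) (ℤ.pos-+ (w q n) n))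
    (trans (ℤ.pos-+ (q ℕ.* n) r) (cong (_+ + r) (ℤ.pos-* q n))))
  (lemma θ c (+ w q n) (+ q) (+ n) (+ r))
  where
  lemma : ∀ θ c w q n r → θ * (w + n) + c * (q * n + r) ≡ θ * w + (θ + q * c) * n + r * c
  lemma = solve-∀

linear-0 : ∀ q θ c → linear q θ c 0 ≡ 0ℤ
linear-0 q θ c = cong₂ _+_ (ℤ.*-zeroʳ θ) (ℤ.*-zeroʳ c)

linear-1 : ∀ {q} → 2 ≤ q → ∀ θ c → linear q θ c 1 ≡ c
linear-1 {q} 2≤q θ c = begin
  linear q θ c 1                              ≡⟨ cong (λ n → linear q θ c (n ℕ.+ 1)) (ℕ.*-zeroʳ q) ⟨
  linear q θ c (q ℕ.* 0 ℕ.+ 1)                ≡⟨ linear-*+ 2≤q θ c 0 1 2≤q ⟩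
  linear q θ (θ + + q * c) 0 + 1ℤ * c         ≡⟨ cong₂ _+_ (linear-0 q θ (θ + + q * c)) (ℤ.*-identityˡ c) ⟩
  0ℤ + c                                      ≡⟨ ℤ.+-identityˡ c ⟩
  c                                           ∎
  where open ≡-Reasoning

linear-base : ∀ {q} → 2 ≤ q → ∀ θ c → linear q θ c q ≡ θ + + q * c
linear-base {q@(suc _)} 2≤q θ c = begin
  linear q θ c q
    ≡⟨ cong (linear q θ c) (trans (ℕ.+-identityʳ (q ℕ.* 1)) (ℕ.*-identityʳ q)) ⟨
  linear q θ c (q ℕ.* 1 ℕ.+ 0)                ≡⟨ linear-*+ 2≤q θ c 1 0 (s≤s z≤n) ⟩
  linear q θ (θ + + q * c) 1 + 0ℤ * c         ≡⟨ cong₂ _+_ (linear-1 2≤q θ (θ + + q * c)) (ℤ.*-zeroˡ c) ⟩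
  θ + + q * c + 0ℤ                            ≡⟨ ℤ.+-identityʳ _ ⟩
  θ + + q * c                                 ∎
  where open ≡-Reasoning

-- Induction removes the lowest digit m₀ of m; the one-digit recursion, read backwards, restores the
-- original c in the term at m. When the orbit returns to c modulo d, this is additivity in base
-- q^k.
linear-^*+ : ∀ {q} → 2 ≤ q → ∀ θ k c n m → m < q ^ k →
  linear q θ c (q ^ k ℕ.* n ℕ.+ m) ≡ linear q θ (orbit q θ k c) n + linear q θ c m
linear-^*+ {q} 2≤q θ zero c n zero _ = trans
  (cong (linear q θ c) (trans (ℕ.+-identityʳ (1 ℕ.* n)) (ℕ.*-identityˡ n)))
  (sym (trans (cong (λ z → linear q θ c n + z) (linear-0 q θ c)) (ℤ.+-identityʳ _)))
linear-^*+ 2≤q θ zero c n (suc _) (s≤s ())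
linear-^*+ {q@(suc _)} 2≤q θ (suc k) c n m m<q^1+k = begin
  linear q θ c (q ^ suc k ℕ.* n ℕ.+ m)
    ≡⟨ cong (linear q θ c) (trans (cong (q ^ suc k ℕ.* n ℕ.+_) (divMod q m)) (regroup q (q ^ k) n m₁ m₀)) ⟩
  linear q θ c (q ℕ.* (q ^ k ℕ.* n ℕ.+ m₁) ℕ.+ m₀)
    ≡⟨ linear-*+ 2≤q θ c (q ^ k ℕ.* n ℕ.+ m₁) m₀ m₀<q ⟩
  linear q θ c′ (q ^ k ℕ.* n ℕ.+ m₁) + + m₀ * c
    ≡⟨ cong (_+ + m₀ * c) (linear-^*+ 2≤q θ k c′ n m₁ m₁<q^k) ⟩
  linear q θ (orbit q θ k c′) n + linear q θ c′ m₁ + + m₀ * c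
    ≡⟨ ℤ.+-assoc (linear q θ (orbit q θ k c′) n) (linear q θ c′ m₁) (+ m₀ * c) ⟩
  linear q θ (orbit q θ k c′) n + (linear q θ c′ m₁ + + m₀ * c)
    ≡⟨ cong (λ z → linear q θ (orbit q θ k c′) n + z) (linear-*+ 2≤q θ c m₁ m₀ m₀<q) ⟨
  linear q θ (orbit q θ k c′) n + linear q θ c (q ℕ.* m₁ ℕ.+ m₀)
    ≡⟨ cong (λ z → linear q θ (orbit q θ k c′) n + linear q θ c z) (divMod q m) ⟨
  linear q θ (orbit q θ (suc k) c) n + linear q θ c m ∎
  where
  open ≡-Reasoning
  c′ : ℤ
  c′ = θ + + q * c
  m₀ m₁ : ℕ
  m₀ = m ℕ.% q
  m₁ = m ℕ./ q
  m₀<q : m₀ < q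
  m₀<q = ℕ.m%n<n m q
  m₁<q^k : m₁ < q ^ k
  m₁<q^k = ℕ.m<n*o⇒m/o<n (subst (m <_) (ℕ.*-comm q (q ^ k)) m<q^1+k)
  regroup : ∀ K x n m₁ m₀ → K ℕ.* x ℕ.* n ℕ.+ (K ℕ.* m₁ ℕ.+ m₀) ≡ K ℕ.* (x ℕ.* n ℕ.+ m₁) ℕ.+ m₀
  regroup = ℕSolver.solve-∀

LinearDensity : ℕ → ℕ → ℤ → ℤ → ℤ → Set
LinearDensity d q θ c t = HasDensity (Σ< λ n → ind d (linear q θ c n + t))

-- Each step back along the orbit splits n by its last digit r and changes t into r c + t, so
-- densities for all t are carried along.
orbit-density : ∀ d {q} → 2 ≤ q → ∀ θ k c →
  (∀ t → LinearDensity d q θ (orbit q θ k c) t) → ∀ t → LinearDensity d q θ c t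
orbit-density d 2≤q θ zero    c dens = dens
orbit-density d {q@(suc _)} 2≤q θ (suc k) c dens t =
  HasDensity-block q (λ n → ind d (linear q θ c n + t)) (λ n → ∣ind∣≤1 d _) λ r r<q →
    HasDensity-cong
      (λ N → Σ<-cong N λ n _ → cong (ind d)
        (sym (trans (cong (_+ t) (linear-*+ 2≤q θ c n r r<q))
          (ℤ.+-assoc (linear q θ (θ + + q * c) n) (+ r * c) t))))
      (orbit-density d 2≤q θ k (θ + + q * c) dens (+ r * c + t))

-- Appending the base K digit s to m adds f(s) to the value; this is done a times.
Additive-reach : ∀ {d K f} → Additive d K f → ∀ s → s < K → ∀ a j m → m < K ^ j →
  ∃ λ m′ → m′ < K ^ (a ℕ.+ j) × f m′ ≡ f m + + a * f s [mod d ]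
Additive-reach {f = f} add s s<K zero    j m m<K^j =
  m , m<K^j , ≡⇒≡mod (sym (trans (cong (λ z → f m + z) (ℤ.*-zeroˡ (f s))) (ℤ.+-identityʳ (f m))))
Additive-reach {d} {K} {f} add s s<K (suc a) j m m<K^j
  with m′ , m′<K^a+j , fm′≡ ← Additive-reach {f = f} add s s<K a j m m<K^j =
  K ℕ.* m′ ℕ.+ s , bound ,
  mod-trans (add m′ s s<K) (subst (f m′ + f s ≡_[mod d ])
    (trans (lemma (f m) (+ a) (f s)) (cong (λ z → f m + z * f s) (sym (ℤ.pos-+ 1 a))))
    (mod-+ fm′≡ (mod-refl (f s))))
  where
  lemma : ∀ x a y → x + a * y + y ≡ x + (1ℤ + a) * y
  lemma = solve-∀
  bound : K ℕ.* m′ ℕ.+ s < K ^ suc (a ℕ.+ j)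
  bound = begin-strict
    K ℕ.* m′ ℕ.+ s       <⟨ ℕ.+-monoʳ-< (K ℕ.* m′) s<K ⟩
    K ℕ.* m′ ℕ.+ K       ≡⟨ trans (ℕ.+-comm (K ℕ.* m′) K) (sym (ℕ.*-suc K m′)) ⟩
    K ℕ.* suc m′         ≤⟨ ℕ.*-monoʳ-≤ K m′<K^a+j ⟩
    K ^ suc (a ℕ.+ j)    ∎
    where open ℕ.≤-Reasoning

equidistribution : ∀ d .{{_ : NonZero d}} K .{{_ : NonZero K}} f → Additive d K f →
  (∀ x → ∃ λ m → m < K × f m ≡ x [mod d ]) → ∀ t → HasDensity (Σ< λ n → ind d (f n + t))
equidistribution d (suc p) f add cover = Equidistribution.equidistributed d p f add cover

-- The last hypothesis says gcd(c, θ, d) = 1, so f(1) = c and f(q) = θ + q c generate ℤ/d. Since P ≥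
-- 2, both 1 and q are single digits in base Q = q^P.
coprime-density : ∀ d .{{_ : NonZero d}} {q} → 2 ≤ q → ∀ θ c P → 2 ≤ P →
  orbit q θ P c ≡ c [mod d ] → ∀ α β κ → 1ℤ ≡ α * c + β * θ + κ * + d →
  ∀ t → LinearDensity d q θ c t
coprime-density d {q@(suc _)} 2≤q θ c P 2≤P period α β κ 1≡ =
  -- The exponent leaves room for d digits q and d digits 1.
  equidistribution d (Q ^ (d ℕ.+ d)) f (Additive-^ {f = f} (linear-0 q θ c) additive (d ℕ.+ d)) cover
  where
  Q : ℕ
  Q = q ^ P
  instance
    Q≢0 : NonZero Q
    Q≢0 = ℕ.m^n≢0 q P
    K≢0 : NonZero (Q ^ (d ℕ.+ d))
    K≢0 = ℕ.m^n≢0 Q (d ℕ.+ d)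
  f : ℕ → ℤ
  f = linear q θ c
  additive : Additive d Q f
  additive n m m<Q = subst (_≡ f n + f m [mod d ]) (sym (linear-^*+ 2≤q θ P c n m m<Q))
    (mod-+ (mod-+ (mod-refl (θ * + w q n)) (mod-*ʳ (+ n) period)) (mod-refl (f m)))
  q<Q : q < Q
  q<Q = ℕ.<-≤-trans
    (subst (_< q ^ 2) (ℕ.*-identityʳ q)
      (ℕ.*-monoʳ-< q (subst (1 <_) (sym (ℕ.*-identityʳ q)) 2≤q)))
    (ℕ.^-monoʳ-≤ q 2≤P)
  1<Q : 1 < Q
  1<Q = ℕ.<-trans 2≤q q<Q
  lemma₁ : ∀ x α β θ c q κ d →
    0ℤ + x * β * (θ + q * c) + (x * α - x * β * q) * c - x
      ≡ x * (α * c + β * θ + κ * d) - x - x * κ * d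
  lemma₁ = solve-∀
  lemma₂ : ∀ x κ d → x * 1ℤ - x - x * κ * d ≡ - (x * κ) * d
  lemma₂ = solve-∀
  -- x ≡ x (α c + β θ) = x β (θ + q c) + (x α − x β q) c, and f q = θ + q c, f 1 = c.
  combination : ∀ x → f 0 + x * β * f q + (x * α - x * β * + q) * f 1 ≡ x [mod d ]
  combination x = congruent (divides (- (x * κ)) (begin
    f 0 + x * β * f q + (x * α - x * β * + q) * f 1 - x
      ≡⟨ cong₂ (λ y z → y + x * β * z + (x * α - x * β * + q) * f 1 - x)
           (linear-0 q θ c) (linear-base 2≤q θ c) ⟩
    0ℤ + x * β * (θ + + q * c) + (x * α - x * β * + q) * f 1 - x
      ≡⟨ cong (λ z → 0ℤ + x * β * (θ + + q * c) + (x * α - x * β * + q) * z - x) (linear-1 2≤q θ c) ⟩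
    0ℤ + x * β * (θ + + q * c) + (x * α - x * β * + q) * c - x
      ≡⟨ lemma₁ x α β θ c (+ q) κ (+ d) ⟩
    x * (α * c + β * θ + κ * + d) - x - x * κ * + d
      ≡⟨ cong (λ z → x * z - x - x * κ * + d) 1≡ ⟨
    x * 1ℤ - x - x * κ * + d
      ≡⟨ lemma₂ x κ (+ d) ⟩
    - (x * κ) * + d ∎))
    where open ≡-Reasoning
  cover : ∀ x → ∃ λ m → m < Q ^ (d ℕ.+ d) × f m ≡ x [mod d ]
  cover x =
    -- Starting from 0 with no digits, the digit q is appended a times and then the digit 1 b times;
    -- a and b are the required coefficients reduced modulo d.
    let m , m<Q^a , fm≡ = Additive-reach {f = f} additive q q<Q a 0 0 (s≤s z≤n)
        m′ , m′<Q^b+a , fm′≡ = Additive-reach {f = f} additive 1 1<Q b (a ℕ.+ 0) m m<Q^a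
    in m′ , ℕ.<-≤-trans m′<Q^b+a (ℕ.^-monoʳ-≤ Q exponent) ,
       mod-trans fm′≡ (mod-trans (mod-+ fm≡ (mod-refl (+ b * f 1)))
         (mod-trans (mod-+ (mod-+ (mod-refl (f 0)) (mod-*ʳ (f q) a≡)) (mod-*ʳ (f 1) b≡)) (combination x)))
    where
    a b : ℕ
    a = residue d (x * β)
    b = residue d (x * α - x * β * + q)
    a≡ : + a ≡ x * β [mod d ]
    a≡ = mod-sym (residue-mod d (x * β))
    b≡ : + b ≡ x * α - x * β * + q [mod d ]
    b≡ = mod-sym (residue-mod d (x * α - x * β * + q))
    exponent : b ℕ.+ (a ℕ.+ 0) ≤ d ℕ.+ d
    exponent = ℕ.+-mono-≤ (ℕ.<⇒≤ (residue< d (x * α - x * β * + q)))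
      (subst (_≤ d) (sym (ℕ.+-identityʳ a)) (ℕ.<⇒≤ (residue< d (x * β))))

-- The orbit is sampled at even times to get a period P ≥ 2, hence q < qᴾ.
orbit-period : ∀ d .{{_ : NonZero d}} q θ c → ∃₂ λ k P → 2 ≤ P ×
  orbit q θ P (orbit q θ k c) ≡ orbit q θ k c [mod d ]
orbit-period d q θ c with i , j , i<j , eq ←
    pigeonhole (ℕ.n<1+n d) (λ i → fromℕ< (residue< d (orbit q θ (2 ℕ.* toℕ i) c))) =
  2 ℕ.* toℕ i , 2 ℕ.* (toℕ j ℕ.∸ toℕ i) ,
  ℕ.*-monoʳ-≤ 2 (ℕ.m<n⇒0<n∸m i<j) ,
  subst (_≡ orbit q θ (2 ℕ.* toℕ i) c [mod d ])
    (trans (cong (λ k → orbit q θ k c) 2j≡) (orbit-+ q θ (2 ℕ.* toℕ i) (2 ℕ.* (toℕ j ℕ.∸ toℕ i)) c))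
    (mod-trans (residue-mod d (orbit q θ (2 ℕ.* toℕ j) c))
      (subst (λ r → + r ≡ orbit q θ (2 ℕ.* toℕ i) c [mod d ])
        (fromℕ<-injective _ _ (residue< d (orbit q θ (2 ℕ.* toℕ i) c))
          (residue< d (orbit q θ (2 ℕ.* toℕ j) c)) eq)
        (mod-sym (residue-mod d (orbit q θ (2 ℕ.* toℕ i) c)))))
  where
  2j≡ : 2 ℕ.* toℕ j ≡ 2 ℕ.* toℕ i ℕ.+ 2 ℕ.* (toℕ j ℕ.∸ toℕ i)
  2j≡ = trans (cong (2 ℕ.*_) (sym (ℕ.m+[n∸m]≡n (ℕ.<⇒≤ i<j)))) (ℕ.*-distribˡ-+ 2 (toℕ i) (toℕ j ℕ.∸ toℕ i))

linear-*ʳ : ∀ q θ c h n → linear q (θ * h) (c * h) n ≡ linear q θ c n * h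
linear-*ʳ q θ c h n = lemma θ c h (+ w q n) (+ n)
  where
  lemma : ∀ θ c h w n → θ * h * w + c * h * n ≡ (θ * w + c * n) * h
  lemma = solve-∀

-- The common factor h is displayed in the modulus and in both coefficients, so that dividing by it
-- just drops it; what remains satisfies the hypotheses of `coprime-density`.
scaled-density : ∀ d h .{{_ : NonZero d}} .{{_ : NonZero h}} {q} → 2 ≤ q → ∀ θ c P → 2 ≤ P →
  orbit q (θ * + h) P (c * + h) ≡ c * + h [mod d ℕ.* h ] →
  ∀ α β κ → + h ≡ α * (c * + h) + β * (θ * + h) + κ * + (d ℕ.* h) →
  ∀ t → LinearDensity (d ℕ.* h) q (θ * + h) (c * + h) t
scaled-density d h {q} 2≤q θ c P 2≤P period α β κ h≡ t with + h ∣? t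
... | yes (divides t′ refl) = HasDensity-cong
  (λ N → Σ<-cong N λ n _ → ind-cong
    (λ d∣ → subst₂ _∣_ (sym (ℤ.pos-* d h)) (factor n) (*-monoˡ-∣ (+ h) d∣))
    (λ dh∣ → *-cancelʳ-∣ (+ h) (subst₂ _∣_ (ℤ.pos-* d h) (sym (factor n)) dh∣)))
  (coprime-density d 2≤q θ c P 2≤P period′ α β κ 1≡ t′)
  where
  factor : ∀ n → (linear q θ c n + t′) * + h ≡ linear q (θ * + h) (c * + h) n + t′ * + h
  factor n = trans (ℤ.*-distribʳ-+ (+ h) (linear q θ c n) t′)
    (cong (_+ t′ * + h) (sym (linear-*ʳ q θ c (+ h) n)))
  period′ : orbit q θ P c ≡ c [mod d ]
  period′ = congruent (*-cancelʳ-∣ (+ h) (subst₂ _∣_ (ℤ.pos-* d h)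
    (trans (cong (_- c * + h) (orbit-*ʳ q θ P c (+ h))) (lemma (orbit q θ P c) c (+ h)))
    (difference period)))
    where
    lemma : ∀ x c h → x * h - c * h ≡ (x - c) * h
    lemma = solve-∀
  1≡ : 1ℤ ≡ α * c + β * θ + κ * + d
  1≡ = ℤ.*-cancelʳ-≡ 1ℤ (α * c + β * θ + κ * + d) (+ h) (trans (ℤ.*-identityˡ (+ h)) (trans h≡
    (trans (cong (λ z → α * (c * + h) + β * (θ * + h) + κ * z) (ℤ.pos-* d h))
      (lemma α β κ c θ (+ d) (+ h)))))
    where
    lemma : ∀ α β κ c θ d h → α * (c * h) + β * (θ * h) + κ * (d * h) ≡ (α * c + β * θ + κ * d) * h
    lemma = solve-∀
-- Every value of the linear part is a multiple of h, so a zero modulo d h would force h to divide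
-- t: the count is identically 0.
... | no h∤t = HasDensity-cong
  (λ N → sym (Σ<-zero N λ n _ → ind-no λ dh∣ → h∤t (∣m+n∣m⇒∣n
    (∣-trans (divides (+ d) (ℤ.pos-* d h)) dh∣)
    (divides (linear q θ c n) (linear-*ʳ q θ c (+ h) n)))))
  HasDensity-0

common-divisor-density : ∀ d .{{_ : NonZero d}} {q} → 2 ≤ q → ∀ θ c P → 2 ≤ P →
  orbit q θ P c ≡ c [mod d ] →
  ∀ h → h ℕ.∣ d → + h ∣ c → + h ∣ θ → ∀ α β κ → + h ≡ α * c + β * θ + κ * + d →
  ∀ t → LinearDensity d q θ c t
common-divisor-density d 2≤q θ c P 2≤P period h
  (ℕ.divides d′ refl) (divides c′ refl) (divides θ′ refl) =
  scaled-density d′ h {{ℕ.m*n≢0⇒m≢0 d′}} {{ℕ.m*n≢0⇒n≢0 d′}} 2≤q θ′ c′ P 2≤P period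

-- Two applications of Bézout produce h = gcd(gcd(c, θ), d) as a combination of all three.
periodic-density : ∀ d .{{_ : NonZero d}} {q} → 2 ≤ q → ∀ θ c P → 2 ≤ P →
  orbit q θ P c ≡ c [mod d ] → ∀ t → LinearDensity d q θ c t
periodic-density d 2≤q θ c P 2≤P period =
  let g , g∣c , g∣θ , α , β , g≡ = bezout c θ
      h , h∣g , h∣d , μ , κ , h≡ = bezout (+ g) (+ d)
  in common-divisor-density d 2≤q θ c P 2≤P period h (∣⇒∣ᵤ h∣d) (∣-trans h∣g g∣c) (∣-trans h∣g g∣θ)
       (μ * α) (μ * β) κ
       (trans h≡ (trans (cong (λ z → μ * z + κ * + d) g≡) (lemma μ α β κ c θ (+ d))))
  where
  lemma : ∀ μ α β κ c θ d → μ * (α * c + β * θ) + κ * d ≡ μ * α * c + μ * β * θ + κ * d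
  lemma = solve-∀

linear-density : ∀ d .{{_ : NonZero d}} {q} → 2 ≤ q → ∀ θ c t → LinearDensity d q θ c t
linear-density d {q} 2≤q θ c =
  let k , P , 2≤P , period = orbit-period d q θ c
  in orbit-density d 2≤q θ k c (periodic-density d 2≤q θ (orbit q θ k c) P 2≤P period)

-- Reduction of the general forms

FormDensity : ℕ → ℕ → ℤ⁵ → Set
FormDensity d q s = HasDensity (Σ< λ n → ind d (form q s n))

form-density-next : ∀ d {p} → 2 ≤ suc p → ∀ s →
  (∀ r → FormDensity d (suc p) (next p r s)) → FormDensity d (suc p) s
form-density-next d {p} 2≤q s dens =
  HasDensity-block (suc p) (λ n → ind d (form (suc p) s n)) (λ n → ∣ind∣≤1 d (form (suc p) s n)) λ r r<q →
    HasDensity-cong (λ N → Σ<-cong N λ n _ → cong (ind d) (sym (form-*+ 2≤q s n r r<q))) (dens r)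

form-density-linear : ∀ d .{{_ : NonZero d}} {q} → 2 ≤ q → ∀ θu θw θ₂ θ₁ θ₀ →
  + d ∣ θu → + d ∣ θ₂ → FormDensity d q (θu , θw , θ₂ , θ₁ , θ₀)
form-density-linear d {q} 2≤q θu θw θ₂ θ₁ θ₀ d∣θu d∣θ₂ = HasDensity-cong
  (λ N → Σ<-cong N λ n _ → sym (ind-mod (congruent
    (subst (+ d ∣_) (lemma θu θw θ₂ θ₁ θ₀ (+ u q n) (+ w q n) (+ triangle n) (+ n))
      (∣m∣n⇒∣m+n (∣m⇒∣m*n (+ u q n) d∣θu) (∣m⇒∣m*n (+ triangle n) d∣θ₂))))))
  (linear-density d 2≤q θw θ₁ θ₀)
  where
  lemma : ∀ θu θw θ₂ θ₁ θ₀ u w t n →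
    θu * u + θ₂ * t ≡ θu * u + θw * w + θ₂ * t + θ₁ * n + θ₀ - (θw * w + θ₁ * n + θ₀)
  lemma = solve-∀

θᵤ-of θ₂-of : ℤ⁵ → ℤ
θᵤ-of (θu , _)          = θu
θ₂-of (_ , _ , θ₂ , _) = θ₂

-- The new θ₂ is q θu + q² θ₂, and d divides θu. Hence each substitution moves a power of q from the
-- hypothesis into the coefficient, until d divides θ₂ itself and the form is linear modulo d.
form-density-quadratic : ∀ d .{{_ : NonZero d}} {p} → 2 ≤ suc p → ∀ j s →
  + d ∣ θᵤ-of s → + d ∣ + (suc p ^ j) * θ₂-of s → FormDensity d (suc p) s
form-density-quadratic d {p} 2≤q zero (θu , θw , θ₂ , θ₁ , θ₀) d∣θu d∣θ₂ =
  form-density-linear d 2≤q θu θw θ₂ θ₁ θ₀ d∣θu (subst (+ d ∣_) (ℤ.*-identityˡ θ₂) d∣θ₂)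
form-density-quadratic d {p} 2≤q (suc j) s@(θu , _ , θ₂ , _) d∣θu d∣q^j*θ₂ =
  form-density-next d 2≤q s λ r →
    form-density-quadratic d 2≤q j (next p r s) (∣n⇒∣m*n (+ suc p) d∣θu)
      (subst (+ d ∣_)
        (trans (cong (λ z → + (suc p ^ j) * + suc p * θu + + suc p * (z * θ₂)) (ℤ.pos-* (suc p) (suc p ^ j)))
          (lemma (+ (suc p ^ j)) (+ suc p) θu θ₂))
        (∣m∣n⇒∣m+n (∣n⇒∣m*n (+ (suc p ^ j) * + suc p) d∣θu) (∣n⇒∣m*n (+ suc p) d∣q^j*θ₂)))
  where
  lemma : ∀ x q a b → x * q * a + q * (q * x * b) ≡ x * (q * a + q * q * b)
  lemma = solve-∀

-- The first j substitutions clear θu modulo d. They also feed θu into θ₂, but d ∣ q^i makes q^i θ₂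
-- vanish modulo d for every θ₂, so the quadratic phase can then start with exponent i.
form-density : ∀ d .{{_ : NonZero d}} {p} → 2 ≤ suc p → ∀ i → d ℕ.∣ suc p ^ i →
  ∀ j s → + d ∣ + (suc p ^ j) * θᵤ-of s → FormDensity d (suc p) s
form-density d {p} 2≤q i d∣q^i zero s@(θu , _ , θ₂ , _) d∣θu =
  form-density-quadratic d 2≤q i s (subst (+ d ∣_) (ℤ.*-identityˡ θu) d∣θu)
    (∣m⇒∣m*n {m = + (suc p ^ i)} θ₂ (∣ᵤ⇒∣ d∣q^i))
form-density d {p} 2≤q i d∣q^i (suc j) s@(θu , _) d∣q^j*θu =
  form-density-next d 2≤q s λ r →
    form-density d 2≤q i d∣q^i j (next p r s)
      (subst (+ d ∣_)
        (trans (cong (_* θu) (trans (ℤ.pos-* (suc p) (suc p ^ j)) (ℤ.*-comm (+ suc p) (+ (suc p ^ j)))))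
          (ℤ.*-assoc (+ (suc p ^ j)) (+ suc p) θu))
        d∣q^j*θu)

theorem3p1 : ∀ d q → 2 ≤ d → 2 ≤ q →
    (∀ θw θ₁ θ₀ → DensityExists q d (0ℤ , θw , 0ℤ , θ₁ , θ₀))
    × ((∃ λ n → d ℕ.∣ q ^ n) → ∀ s → DensityExists q d s)
theorem3p1 d@(suc _) q@(suc _) 2≤d 2≤q =
  (λ θw θ₁ θ₀ → densityExists q d (0ℤ , θw , 0ℤ , θ₁ , θ₀)
    (form-density-linear d 2≤q 0ℤ θw 0ℤ θ₁ θ₀ d∣0 d∣0)) ,
  -- The same exponent n serves both phases, for θu and for θ₂.
  λ (n , d∣q^n) s → densityExists q d s
    (form-density d 2≤q n d∣q^n n s (∣m⇒∣m*n {m = + (q ^ n)} (θᵤ-of s) (∣ᵤ⇒∣ d∣q^n)))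
  where
  d∣0 : + d ∣ 0ℤ
  d∣0 = divides 0ℤ refl
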